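{- For each $n\geq 1$, $$\max_{\equiv}\ \max_{w\in S_n}\ \lvert D_R(\mathbf S_\equiv(w))\rvert=\left\lfloor\frac{2(n-1)}{3}\right\rfloor,$$ where the first maximum is over all essential lattice congruences $\equiv$ on the left weak order of the symmetric group $S_n$.
   Context: $S_n$ is the symmetric group, with simple generators $s_i=(i\;\,i+1)$, $1\le i\le n-1$; products are compositions of functions and $\ell$ is Coxeter length. The left weak order is $x\leq_L y \iff \ell(yx^{ -1})=\ell(y)-\ell(x)$; it is a lattice on $S_n$. The right descent set is $D_R(w)=\{s_i:\ell(ws_i)<\ell(w)\}=\{s_i: w(i)>w(i+1)\}$. A lattice congruence on a lattice is an equivalence relation $\equiv$ such that $x_1\equiv x_2$ and $y_1\equiv y_2$ imply $x_1\wedge y_1\equiv x_2\wedge y_2$ and $x_1\vee y_1\equiv x_2\vee y_2$. It is essential (on $(S_n,\leq_L)$) if the identity $e$ forms a singleton congruence class. Every congruence class has a unique minimal element; $\pi_\downarrow^\equiv(w)$ denotes the minimal element of the class of $w$. The Coxeter stack-sorting operator is $\mathbf S_\equiv:S_n\to S_n$, $\mathbf S_\equiv(w)=w\,(\pi_\downarrow^\equiv(w))^{ -1}$. -}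

module Defs where

open import Data.Nat.Base using (ℕ; zero; suc; _+_; _∸_; _≤_; z≤n; s≤s)
open import Data.Nat.Properties
  using (_<?_; ≤-total; suc-injective; m∸n+n≡m; m≢1+n+m; 1+n≢n)
open import Data.Fin.Base using (Fin; zero; suc; toℕ; inject₁)
open import Data.Fin.Properties using (_≟_; any?; all?; toℕ-injective; toℕ-inject₁)
open import Data.Fin.Permutation as Perm
  using (Permutation′; _≈_; _⟨$⟩ʳ_; transpose; _∘ₚ_; flip)
import Data.Fin.Permutation.Components as PC
open import Data.Fin.Permutation.Transposition.List using (decompose; eval; eval-decompose)
open import Data.Fin.Subset using (Subset)
open import Data.List.Base using ([]; _∷_)
open import Data.Vec.Base as Vec using (Vec; []; _∷_; tabulate)
open import Data.Product.Base using (∃; ∃-syntax; _×_; _,_; proj₁; proj₂)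
open import Data.Sum.Base using (inj₁; inj₂)
open import Function.Base using (_∘_)
open import Level using (0ℓ)
open import Relation.Binary.Core using (Rel)
open import Relation.Binary.Structures using (IsEquivalence)
open import Relation.Binary.PropositionalEquality
  using (_≡_; _≢_; refl; sym; trans; cong)
open import Relation.Nullary using (Dec; yes; no; does; contradiction)
open import Relation.Nullary.Decidable using (map′; dec-true; dec-false)
open import Relation.Unary using (Decidable)

private
  variable
    n : ℕ

-- Permutations act on {0,…,n-1} instead of {1,…,n}, and are compared by
-- pointwise equality _≈_.
S : ℕ → Set
S n = Permutation′ n

e : S n
e = Perm.id

infixl 7 _·_
infix  8 _⁻¹

-- Composition of functions, (x · y)(i) = x(y(i)); the library's _∘ₚ_ composes
-- in the opposite order.
_·_ : S n → S n → S n
x · y = y ∘ₚ x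

_⁻¹ : S n → S n
_⁻¹ = flip

-- s i exchanges i and i + 1, for 0 ≤ i < n - 1.
s : Fin (n ∸ 1) → S n
s {suc n} i = transpose (inject₁ i) (suc i)

prod : ∀ {k} → Vec (Fin (n ∸ 1)) k → S n
prod []       = e
prod (i ∷ is) = s i · prod is

HasWord : S n → ℕ → Set
HasWord {n} w k = ∃[ is ] prod {n} {k} is ≈ w

private

  -- The simple generators generate: every transposition is a product of them,
  -- since (a c) = (b c)(a b)(b c), and every permutation is a product of
  -- transpositions.

  Gen : S n → Set
  Gen w = ∃ (HasWord w)

  gen-resp : (x y : S n) → x ≈ y → Gen x → Gen y
  gen-resp _ _ x≈y (k , is , p) = k , is , λ i → trans (p i) (x≈y i)

  gen-s : (i : Fin (n ∸ 1)) → Gen {n} (s i)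
  gen-s i = 1 , i ∷ [] , λ _ → refl

  prod-++ : ∀ {k l} (is : Vec (Fin (n ∸ 1)) k) (js : Vec (Fin (n ∸ 1)) l) →
            prod {n} (is Vec.++ js) ≈ prod is · prod js
  prod-++ []       js x = refl
  prod-++ {n} (i ∷ is) js x = cong (s {n} i ⟨$⟩ʳ_) (prod-++ is js x)

  gen-· : (x y : S n) → Gen x → Gen y → Gen (x · y)
  gen-· x _ (k , is , p) (l , js , q) =
    k + l , is Vec.++ js ,
    λ i → trans (prod-++ is js i) (trans (p _) (cong (x ⟨$⟩ʳ_) (q i)))

  t-left : (a b : Fin n) → PC.transpose a b a ≡ b
  t-left a b rewrite dec-true (a ≟ a) refl = refl

  t-right : (a b : Fin n) → PC.transpose a b b ≡ a
  t-right a b with b ≟ a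
  ... | yes b≡a = b≡a
  ... | no  _ rewrite dec-true (b ≟ b) refl = refl

  t-other : (a b x : Fin n) → x ≢ a → x ≢ b → PC.transpose a b x ≡ x
  t-other a b x x≢a x≢b
    rewrite dec-false (x ≟ a) x≢a | dec-false (x ≟ b) x≢b = refl

  t-conj : (a b c : Fin n) → a ≢ b → a ≢ c → b ≢ c →
           transpose b c · transpose a b · transpose b c ≈ transpose a c
  t-conj a b c a≢b a≢c b≢c x = go (x ≟ a) (x ≟ b) (x ≟ c)
    where
    f = PC.transpose b c
    g = PC.transpose a b
    go : Dec (x ≡ a) → Dec (x ≡ b) → Dec (x ≡ c) → f (g (f x)) ≡ PC.transpose a c x
    go (yes refl) _ _
      rewrite t-other b c a a≢b a≢c | t-left a b | t-left b c | t-left a c = refl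
    go (no x≢a) (yes refl) _
      rewrite t-left b c | t-other a b c (a≢c ∘ sym) (b≢c ∘ sym) | t-right b c
            | t-other a c b (a≢b ∘ sym) b≢c = refl
    go (no x≢a) (no x≢b) (yes refl)
      rewrite t-right b c | t-right a b | t-other b c a a≢b a≢c | t-right a c = refl
    go (no x≢a) (no x≢b) (no x≢c)
      rewrite t-other b c x x≢b x≢c | t-other a b x x≢a x≢b | t-other b c x x≢b x≢c
            | t-other a c x x≢a x≢c = refl

  t-sym : (a b : Fin n) → transpose a b ≈ transpose b a
  t-sym a b x = go (x ≟ a) (x ≟ b)
    where
    go : Dec (x ≡ a) → Dec (x ≡ b) → PC.transpose a b x ≡ PC.transpose b a x
    go (yes refl) _ rewrite t-left a b | t-right b a = refl
    go (no _) (yes refl) rewrite t-left b a | t-right a b = refl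
    go (no p) (no q) rewrite t-other a b x p q | t-other b a x q p = refl

  t-refl : (a : Fin n) → e ≈ transpose a a
  t-refl a x with x ≟ a
  ... | yes refl = refl
  ... | no p rewrite dec-false (x ≟ a) p = refl

  -- d is the distance between a and c.
  gen-up : ∀ d (a c : Fin n) → toℕ c ≡ d + toℕ a → Gen (transpose a c)
  gen-up zero a c eq with toℕ-injective eq
  ... | refl = gen-resp e (transpose a a) (t-refl a) (0 , [] , λ _ → refl)
  gen-up {suc n} (suc d) a (suc b) eq with a ≟ inject₁ b
  ... | yes refl = gen-s {suc n} b
  ... | no a≢b = gen-resp (sᵇ · tᵃ · sᵇ) (transpose a (suc b)) (t-conj a (inject₁ b) (suc b) a≢b a≢c b≢c)
                   (gen-· (sᵇ · tᵃ) sᵇ (gen-· sᵇ tᵃ (gen-s {suc n} b) ih) (gen-s {suc n} b))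
    where
    sᵇ = transpose (inject₁ b) (suc b)
    tᵃ = transpose a (inject₁ b)
    a≢c : a ≢ suc b
    a≢c p = m≢1+n+m (toℕ a) (trans (cong toℕ p) eq)
    b≢c : inject₁ b ≢ suc b
    b≢c p = 1+n≢n (sym (trans (sym (toℕ-inject₁ b)) (cong toℕ p)))
    ih : Gen tᵃ
    ih = gen-up d a (inject₁ b) (trans (toℕ-inject₁ b) (suc-injective eq))

  gen-transpose : (a c : Fin n) → Gen (transpose a c)
  gen-transpose a c with ≤-total (toℕ a) (toℕ c)
  ... | inj₁ a≤c = gen-up _ a c (sym (m∸n+n≡m a≤c))
  ... | inj₂ c≤a = gen-resp (transpose c a) (transpose a c) (t-sym c a) (gen-up _ c a (sym (m∸n+n≡m c≤a)))

  gen-eval : ∀ ts → Gen {n} (eval ts)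
  gen-eval []             = 0 , [] , λ _ → refl
  gen-eval ((a , b) ∷ ts) = gen-· (eval ts) (transpose a b) (gen-eval ts) (gen-transpose a b)

generated : (w : S n) → ∃ (HasWord w)
generated w = gen-resp (eval (decompose w)) w (eval-decompose w) (gen-eval (decompose w))

hasWord? : (w : S n) → Decidable (HasWord w)
hasWord? w zero = map′ ([] ,_) (λ { ([] , p) → p }) (all? λ i → i ≟ w ⟨$⟩ʳ i)
hasWord? {n} w (suc k) = map′ to from (any? λ i → hasWord? (s i ⁻¹ · w) k)
  where
  to : (∃[ i ] HasWord (s i ⁻¹ · w) k) → HasWord w (suc k)
  to (i , is , p) = i ∷ is ,
    λ x → trans (cong (s {n} i ⟨$⟩ʳ_) (p x)) (Perm.inverseʳ (s {n} i))

  from : HasWord w (suc k) → ∃[ i ] HasWord (s i ⁻¹ · w) k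
  from (i ∷ is , p) = i , is ,
    λ x → trans (sym (Perm.inverseˡ (s {n} i))) (cong (s {n} i Perm.⟨$⟩ˡ_) (p x))

leastFrom : {P : ℕ → Set} → Decidable P → ∀ k → P k → ∃[ m ] P m × (∀ j → P j → m ≤ j)
leastFrom P? zero p = zero , p , λ _ _ → z≤n
leastFrom {P} P? (suc k) p with P? zero
... | yes p₀ = zero , p₀ , λ _ _ → z≤n
... | no ¬p₀ with leastFrom {P ∘ suc} (P? ∘ suc) k p
...   | m , q , min = suc m , q ,
          λ { zero p₀ → contradiction p₀ ¬p₀ ; (suc j) r → s≤s (min j r) }

least : {P : ℕ → Set} → Decidable P → ∃ P → ∃[ m ] P m × (∀ j → P j → m ≤ j)
least P? (k , p) = leastFrom P? k p

-- The least number of simple generators in a product equal to w.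
ℓ : S n → ℕ
ℓ w = proj₁ (least (hasWord? w) (generated w))

ℓ-hasWord : (w : S n) → HasWord w (ℓ w)
ℓ-hasWord w = proj₁ (proj₂ (least (hasWord? w) (generated w)))

ℓ-minimal : (w : S n) → ∀ k → HasWord w k → ℓ w ≤ k
ℓ-minimal w = proj₂ (proj₂ (least (hasWord? w) (generated w)))

-- As a subset of the index set of the simple generators.
D_R : S n → Subset (n ∸ 1)
D_R w = tabulate λ i → does (ℓ (w · s i) <? ℓ w)

infix 4 _≤L_

-- ℓ(yx⁻¹) = ℓ(y) - ℓ(x), written without truncated subtraction.
_≤L_ : Rel (S n) 0ℓ
x ≤L y = ℓ (y · x ⁻¹) + ℓ x ≡ ℓ y

-- Meets and joins are taken as relations (m is a greatest lower bound, resp.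
-- least upper bound, of x and y), unique up to _≈_.
IsMeet : S n → S n → S n → Set
IsMeet x y m = m ≤L x × m ≤L y × (∀ z → z ≤L x → z ≤L y → z ≤L m)

IsJoin : S n → S n → S n → Set
IsJoin x y j = x ≤L j × y ≤L j × (∀ z → x ≤L z → y ≤L z → j ≤L z)

record LatticeCongruence (n : ℕ) : Set₁ where
  infix 4 _∼_
  field
    _∼_           : Rel (S n) 0ℓ
    isEquivalence : IsEquivalence _∼_
    -- _∼_ is a relation on permutations taken up to pointwise equality.
    ≈⇒∼           : ∀ {x y} → x ≈ y → x ∼ y
    ∧-cong        : ∀ {x₁ x₂ y₁ y₂ m₁ m₂} → x₁ ∼ x₂ → y₁ ∼ y₂ →
                    IsMeet x₁ y₁ m₁ → IsMeet x₂ y₂ m₂ → m₁ ∼ m₂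
    ∨-cong        : ∀ {x₁ x₂ y₁ y₂ j₁ j₂} → x₁ ∼ x₂ → y₁ ∼ y₂ →
                    IsJoin x₁ y₁ j₁ → IsJoin x₂ y₂ j₂ → j₁ ∼ j₂

Essential : LatticeCongruence n → Set
Essential C = ∀ w → w ∼ e → w ≈ e
  where open LatticeCongruence C

-- The graph of π↓.  The unique minimal element of a class is its minimum; giving
-- only the graph lets _∼_ be an arbitrary, possibly undecidable, relation.
π↓[_]_↦_ : LatticeCongruence n → S n → S n → Set
π↓[ C ] w ↦ u = u ∼ w × (∀ v → v ∼ w → u ≤L v)
  where open LatticeCongruence C

-- The graph of the Coxeter stack-sorting operator w ↦ w (π↓ w)⁻¹.
𝐒[_]_↦_ : LatticeCongruence n → S n → S n → Set
𝐒[ C ] w ↦ v = ∃[ u ] (π↓[ C ] w ↦ u) × v ≈ w · u ⁻¹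

IsMaximum : (ℕ → Set₁) → ℕ → Set₁
IsMaximum P m = P m × (∀ k → P k → k ≤ m)

{-# OPTIONS --safe #-}
module Submission where

-- Inversion sets of positions describe the left weak order, and D_R(w) consists
-- of the adjacent inversions.  For the lower bound take the congruence whose
-- classes are the sets of permutations with a given D_R, and the class of
-- 1 32 4 65 7 ….
--
-- For the upper bound let u = π↓(w) and v = w u⁻¹, and let pᵢ be the position of
-- the value i in u; view i as an arc from pᵢ to pᵢ₊₁.  If i ∈ D_R(v), then
-- pᵢ < pᵢ₊₁ and u ≡ sᵢu, so essentiality forbids pᵢ₊₁ = pᵢ + 1.  If pᵢ₊₁ < pᵢ, then
-- sᵢu < u and sᵢu ≢ u by minimality of u.  A position strictly between pᵢ and
-- pᵢ₊₁ makes the curve through (p₁,1), (p₂,2), … return over or under the arc i.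
-- By the forcing order on arcs the first returning arc above (the last one
-- below) cannot cover the arc i, so one of its ends lies strictly between pᵢ and
-- pᵢ₊₁; this determines i from the returning arc.  Hence each of the falling
-- arcs, which are not in D_R(v), is charged by at most two elements of D_R(v),
-- and 3|D_R(v)| ≤ 2(n - 1).

open import Defs
open import Data.Nat using (ℕ; zero; suc; _+_; _≤_; _∸_; _*_; z≤n; s≤s; s≤s⁻¹)
open import Data.Nat.DivMod using (_/_; /-monoˡ-≤; m*n/n≡m; +-distrib-/-∣ˡ)
open import Data.Nat.Divisibility using (divides)
import Data.Nat.Base as ℕ
import Data.Nat.Properties as ℕ
open import Data.Bool.Base using (true; if_then_else_)
open import Data.Fin.Base as F using (Fin; zero; suc; toℕ; inject₁; fromℕ<; punchOut; opposite; _<_)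
import Data.Fin.Properties as F
open import Data.Fin.Permutation
  using (_⟨$⟩ʳ_; _⟨$⟩ˡ_; inverseˡ; inverseʳ; permutation; _≈_; reverse)
open import Data.Fin.Subset using (Subset; _∈_; _⊆_; _-_; ∁; ∣_∣; inside; outside)
open import Data.Fin.Subset.Properties
  using (p⊂q⇒∣p∣<∣q∣; ∣⊤∣≡n; ∈⊤; p⊆q⇒∣p∣≤∣q∣; x∈p⇒∣p-x∣<∣p∣; x∈p∧x≢y⇒x∈p-y; x∉p⇒x∈∁p; ∣∁p∣≡n∸∣p∣; ∣p∣≤n)
open import Data.Product using (Σ-syntax; ∃; ∃-syntax; _×_; _,_; proj₁; proj₂; swap)
open import Data.Sum.Base using (_⊎_; inj₁; inj₂)
open import Data.Unit.Base using (⊤; tt)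
open import Data.Vec.Base using (Vec; []; _∷_; lookup; tabulate; here; there)
open import Data.Vec.Properties using ([]=⇒lookup; lookup⇒[]=; lookup∘tabulate)
open import Function.Base using (_∘_; case_of_)
open import Function.Definitions using (Injective)
open import Relation.Binary.Definitions using (tri<; tri≈; tri>)
open import Relation.Binary.PropositionalEquality hiding (J; isEquivalence)
open import Relation.Binary.Structures using (IsEquivalence)
open import Relation.Nullary using (¬_; Dec; yes; no; does; contradiction)
open import Relation.Nullary.Decidable
  using (_×-dec_; _⊎-dec_; _→-dec_; dec-true; dec-false; from-yes)
open import Relation.Unary using (Decidable)

open import Algebra.Properties.CommutativeMonoid.Sum ℕ.+-0-commutativeMonoid
  using (sum; sum-cong-≗; ∑-distrib-+; ∑-comm; ∑-permute)

private
  variable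
    k m n : ℕ

-- Counting inversions

perm-injective : (w : S n) {c d : Fin n} → w ⟨$⟩ʳ c ≡ w ⟨$⟩ʳ d → c ≡ d
perm-injective w eq = trans (sym (inverseˡ w)) (trans (cong (w ⟨$⟩ˡ_) eq) (inverseˡ w))

not-inverted : (w : S n) {c d : Fin n} → c < d → ¬ (w ⟨$⟩ʳ d < w ⟨$⟩ʳ c) → w ⟨$⟩ʳ c < w ⟨$⟩ʳ d
not-inverted w c<d ¬p = ℕ.≤∧≢⇒< (ℕ.≮⇒≥ ¬p) λ eq →
  F.<-irrefl (perm-injective w (F.toℕ-injective eq)) c<d

χ : {P : Set} → Dec P → ℕ
χ P? = if does P? then 1 else 0

χ-cong : {P Q : Set} (P? : Dec P) (Q? : Dec Q) → (P → Q) → (Q → P) → χ P? ≡ χ Q?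
χ-cong (yes _) (yes _) _ _ = refl
χ-cong (yes p) (no ¬q) f _ = contradiction (f p) ¬q
χ-cong (no ¬p) (yes q) _ g = contradiction (g q) ¬p
χ-cong (no _)  (no _)  _ _ = refl

χ-false : {P : Set} (P? : Dec P) → ¬ P → χ P? ≡ 0
χ-false (yes p) ¬p = contradiction p ¬p
χ-false (no _)  _  = refl

χ≡0⇒false : {P : Set} (P? : Dec P) → χ P? ≡ 0 → ¬ P
χ≡0⇒false (no ¬p) _ = ¬p

sum-zero : (f : Fin n → ℕ) → (∀ i → f i ≡ 0) → sum f ≡ 0
sum-zero {zero}  f z = refl
sum-zero {suc n} f z rewrite z zero = sum-zero (f ∘ suc) (z ∘ suc)

sum≡0 : (f : Fin n → ℕ) → sum f ≡ 0 → ∀ i → f i ≡ 0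
sum≡0 f eq zero    = ℕ.m+n≡0⇒m≡0 (f zero) eq
sum≡0 f eq (suc i) = sum≡0 (f ∘ suc) (ℕ.m+n≡0⇒n≡0 (f zero) eq) i

sum-single : (f : Fin n → ℕ) (p : Fin n) → (∀ i → i ≢ p → f i ≡ 0) → sum f ≡ f p
sum-single {suc n} f zero z =
  trans (cong (f zero +_) (sum-zero (f ∘ suc) λ i → z (suc i) λ ())) (ℕ.+-identityʳ _)
sum-single {suc n} f (suc p) z rewrite z zero (λ ()) =
  sum-single (f ∘ suc) p λ i i≢p → z (suc i) (i≢p ∘ F.suc-injective)

∑₂ : (Fin n → Fin n → ℕ) → ℕ
∑₂ f = sum λ c → sum (f c)

∑₂-cong : {f g : Fin n → Fin n → ℕ} → (∀ c d → f c d ≡ g c d) → ∑₂ f ≡ ∑₂ g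
∑₂-cong eq = sum-cong-≗ λ c → sum-cong-≗ (eq c)

∑₂-+ : (f g : Fin n → Fin n → ℕ) → ∑₂ (λ c d → f c d + g c d) ≡ ∑₂ f + ∑₂ g
∑₂-+ f g = trans (sum-cong-≗ λ c → ∑-distrib-+ (f c) (g c)) (∑-distrib-+ (sum ∘ f) (sum ∘ g))

∑₂-permute : (f : Fin n → Fin n → ℕ) (x : S n) → ∑₂ f ≡ ∑₂ λ c d → f (x ⟨$⟩ʳ c) (x ⟨$⟩ʳ d)
∑₂-permute f x = trans (∑-permute (sum ∘ f) x) (sum-cong-≗ λ c → ∑-permute (f (x ⟨$⟩ʳ c)) x)

inv : S n → ℕ
inv w = ∑₂ λ c d → χ (c F.<? d ×-dec w ⟨$⟩ʳ d F.<? w ⟨$⟩ʳ c)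

inv-resp : (x y : S n) → x ≈ y → inv x ≡ inv y
inv-resp x y x≈y = ∑₂-cong λ c d → cong₂ (λ u v → χ (c F.<? d ×-dec u F.<? v)) (x≈y d) (x≈y c)

-- Reindexing along `w` turns a pair of values `w c < w d` inverted by `w ⁻¹` into the pair of
-- positions `d < c` inverted by `w`.
inv-⁻¹ : (w : S n) → inv (w ⁻¹) ≡ inv w
inv-⁻¹ w = trans (∑₂-permute _ w) (trans (∑₂-cong pointwise) (∑-comm λ c d → χ (ofw d c)))
  where
  ofw : ∀ c d → Dec (c < d × w ⟨$⟩ʳ d < w ⟨$⟩ʳ c)
  ofw c d = c F.<? d ×-dec w ⟨$⟩ʳ d F.<? w ⟨$⟩ʳ c
  pointwise : ∀ c d → χ (w ⟨$⟩ʳ c F.<? w ⟨$⟩ʳ d ×-dec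
                         w ⟨$⟩ˡ (w ⟨$⟩ʳ d) F.<? w ⟨$⟩ˡ (w ⟨$⟩ʳ c)) ≡ χ (ofw d c)
  pointwise c d rewrite inverseˡ w {c} | inverseˡ w {d} =
    χ-cong (w ⟨$⟩ʳ c F.<? w ⟨$⟩ʳ d ×-dec d F.<? c) (ofw d c) (λ (p , q) → q , p) (λ (p , q) → q , p)

module _ (x y : S n) where

  private
    lt? : (w : S n) (c d : Fin n) → Dec (w ⟨$⟩ʳ c < w ⟨$⟩ʳ d)
    lt? w c d = w ⟨$⟩ʳ c F.<? w ⟨$⟩ʳ d

  gained lost : Fin n → Fin n → ℕ
  gained c d = χ (c F.<? d ×-dec lt? x c d ×-dec lt? y d c)
  lost   c d = χ (c F.<? d ×-dec lt? x d c ×-dec lt? y c d)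

  -- The inversions of `y · x ⁻¹` correspond to the symmetric difference of the two inversion sets:
  -- after reindexing along `x`, a pair with `c < d` is counted by `gained` and a pair with `d < c`
  -- by `lost`.
  inv-quotient : inv (y · x ⁻¹) ≡ ∑₂ gained + ∑₂ lost
  inv-quotient =
    trans (∑₂-permute _ x)
    (trans (∑₂-cong λ c d → trans
             (cong₂ (λ u v → χ (lt? x c d ×-dec y ⟨$⟩ʳ u F.<? y ⟨$⟩ʳ v)) (inverseˡ x) (inverseˡ x))
             (split c d (c F.<? d) (d F.<? c)))
    (trans (∑₂-+ gained (λ c d → lost d c)) (cong (∑₂ gained +_) (∑-comm (λ c d → lost d c)))))
    where
    split : ∀ c d (p : Dec (c < d)) (p′ : Dec (d < c)) →
            χ (lt? x c d ×-dec lt? y d c) ≡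
            χ (p ×-dec lt? x c d ×-dec lt? y d c) + χ (p′ ×-dec lt? x c d ×-dec lt? y d c)
    split c d (yes p) (yes p′) = contradiction p′ (F.<-asym p)
    split c d (yes p) (no _)   = sym (ℕ.+-identityʳ _)
    split c d (no _)  (yes _)  = refl
    split c d (no ¬p) (no ¬p′) with F.<-cmp c d
    ... | tri< p _ _     = contradiction p ¬p
    ... | tri≈ _ refl _  = χ-false (lt? x c c ×-dec lt? y c c) λ (q , _) → F.<-irrefl refl q
    ... | tri> _ _ p′    = contradiction p′ ¬p′

  -- Both sides count the pairs inverted by `x` or by `y`.
  inv-exchange : ∑₂ gained + inv x ≡ inv y + ∑₂ lost
  inv-exchange = trans (sym (∑₂-+ gained _)) (trans (∑₂-cong pointwise) (∑₂-+ _ lost))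
    where
    go : ∀ {c d} (p : Dec (c < d))
         (q : Dec (x ⟨$⟩ʳ c < x ⟨$⟩ʳ d)) (q′ : Dec (x ⟨$⟩ʳ d < x ⟨$⟩ʳ c))
         (r : Dec (y ⟨$⟩ʳ c < y ⟨$⟩ʳ d)) (r′ : Dec (y ⟨$⟩ʳ d < y ⟨$⟩ʳ c)) →
         χ (p ×-dec q ×-dec r′) + χ (p ×-dec q′) ≡ χ (p ×-dec r′) + χ (p ×-dec q′ ×-dec r)
    go (no _)  _       _        _       _        = refl
    go (yes _) (yes q) (yes q′) _       _        = contradiction q′ (F.<-asym q)
    go (yes _) _       _        (yes r) (yes r′) = contradiction r′ (F.<-asym r)
    go (yes p) (no ¬q) (no ¬q′) _       _        = contradiction (not-inverted x p ¬q′) ¬q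
    go (yes p) _       _        (no ¬r) (no ¬r′) = contradiction (not-inverted y p ¬r′) ¬r
    go (yes _) (yes _) (no _)   (yes _) (no _)   = refl
    go (yes _) (yes _) (no _)   (no _)  (yes _)  = refl
    go (yes _) (no _)  (yes _)  (yes _) (no _)   = refl
    go (yes _) (no _)  (yes _)  (no _)  (yes _)  = refl

    pointwise : ∀ c d → gained c d + χ (c F.<? d ×-dec lt? x d c) ≡
                        χ (c F.<? d ×-dec lt? y d c) + lost c d
    pointwise c d = go (c F.<? d) (lt? x c d) (lt? x d c) (lt? y c d) (lt? y d c)

  inv-formula : inv (y · x ⁻¹) + inv x ≡ inv y + (∑₂ lost + ∑₂ lost)
  inv-formula = begin
    inv (y · x ⁻¹) + inv x              ≡⟨ cong (_+ inv x) inv-quotient ⟩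
    ∑₂ gained + ∑₂ lost + inv x         ≡⟨ ℕ.+-assoc (∑₂ gained) _ _ ⟩
    ∑₂ gained + (∑₂ lost + inv x)       ≡⟨ cong (∑₂ gained +_) (ℕ.+-comm (∑₂ lost) _) ⟩
    ∑₂ gained + (inv x + ∑₂ lost)       ≡⟨ ℕ.+-assoc (∑₂ gained) _ _ ⟨
    ∑₂ gained + inv x + ∑₂ lost         ≡⟨ cong (_+ ∑₂ lost) inv-exchange ⟩
    inv y + ∑₂ lost + ∑₂ lost           ≡⟨ ℕ.+-assoc (inv y) _ _ ⟩
    inv y + (∑₂ lost + ∑₂ lost)         ∎
    where open ≡-Reasoning

-- Left weak order as inclusion of inversion sets

infix 4 _⊑_

record _⊑_ (x y : S n) : Set where
  constructor ⊑-intro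
  field
    inverted : ∀ {c d} → c < d → x ⟨$⟩ʳ d < x ⟨$⟩ʳ c → y ⟨$⟩ʳ d < y ⟨$⟩ʳ c

open _⊑_ public

⊑-refl : {x : S n} → x ⊑ x
⊑-refl .inverted _ q = q

-- The excess in `inv-formula` is twice the number of lost pairs, so it vanishes exactly when every
-- inversion of `x` survives in `y`.
⊑⇔inv : (x y : S n) → (x ⊑ y → inv (y · x ⁻¹) + inv x ≡ inv y) ×
                      (inv (y · x ⁻¹) + inv x ≡ inv y → x ⊑ y)
⊑⇔inv {n} x y = to , from
  where
  lost? : (c d : Fin n) → Dec (c < d × x ⟨$⟩ʳ d < x ⟨$⟩ʳ c × y ⟨$⟩ʳ c < y ⟨$⟩ʳ d)
  lost? c d = c F.<? d ×-dec x ⟨$⟩ʳ d F.<? x ⟨$⟩ʳ c ×-dec y ⟨$⟩ʳ c F.<? y ⟨$⟩ʳ d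
  to : x ⊑ y → inv (y · x ⁻¹) + inv x ≡ inv y
  to x⊑y = trans (inv-formula x y) (trans (cong (λ k → inv y + (k + k)) none) (ℕ.+-identityʳ _))
    where
    none : ∑₂ (lost x y) ≡ 0
    none = sum-zero _ λ c → sum-zero _ λ d → χ-false (lost? c d)
             λ (p , q , r) → F.<-asym r (inverted x⊑y p q)
  from : inv (y · x ⁻¹) + inv x ≡ inv y → x ⊑ y
  from eq .inverted {c} {d} p q with y ⟨$⟩ʳ d F.<? y ⟨$⟩ʳ c
  ... | yes r = r
  ... | no ¬r = contradiction (p , q , not-inverted y p ¬r)
                  (χ≡0⇒false (lost? c d) (sum≡0 _ (sum≡0 _ none c) d))
    where
    none : ∑₂ (lost x y) ≡ 0
    none = ℕ.m+n≡0⇒m≡0 (∑₂ (lost x y))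
             (ℕ.+-cancelˡ-≡ (inv y) _ 0 (trans (sym (inv-formula x y)) (trans eq (sym (ℕ.+-identityʳ _)))))

-- A cover of the left weak order: the inversion set of `y` is that of `x` with the one pair of
-- positions `(P , Q)` added.
record Cover (x y : S n) (P Q : Fin n) : Set where
  field
    P<Q    : P < Q
    before : x ⟨$⟩ʳ P < x ⟨$⟩ʳ Q
    after  : y ⟨$⟩ʳ Q < y ⟨$⟩ʳ P
    below  : x ⊑ y
    only   : ∀ {c d} → c < d → y ⟨$⟩ʳ d < y ⟨$⟩ʳ c → x ⟨$⟩ʳ d < x ⟨$⟩ʳ c ⊎ (c ≡ P × d ≡ Q)

inv-cover : {x y : S n} {P Q : Fin n} → Cover x y P Q → inv y ≡ suc (inv x)
inv-cover {x = x} {y} {P} {Q} cov =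
  trans (∑₂-cong pointwise) (trans (∑₂-+ _ hit) (trans (cong (inv x +_) one) (ℕ.+-comm _ 1)))
  where
  open Cover cov
  hit : ∀ c d → ℕ
  hit c d = χ (c F.≟ P ×-dec d F.≟ Q)
  one : ∑₂ hit ≡ 1
  one = trans (sum-single _ P λ c c≢P → sum-zero _ λ d → χ-false (c F.≟ P ×-dec d F.≟ Q) (c≢P ∘ proj₁))
        (trans (sum-single _ Q λ d d≢Q → χ-false (P F.≟ P ×-dec d F.≟ Q) (d≢Q ∘ proj₂))
               (χ-cong (P F.≟ P ×-dec Q F.≟ Q) (yes (refl {x = P})) (λ _ → refl) λ _ → refl , refl))
  go : ∀ {c d} (p : Dec (c < d × y ⟨$⟩ʳ d < y ⟨$⟩ʳ c)) (q : Dec (c < d × x ⟨$⟩ʳ d < x ⟨$⟩ʳ c))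
       (h : Dec (c ≡ P × d ≡ Q)) → χ p ≡ χ q + χ h
  go _             (yes (_ , q))  (yes (refl , refl)) = contradiction q (F.<-asym before)
  go (yes _)       (no _)         (yes _)             = refl
  go (no ¬p)       _              (yes (refl , refl)) = contradiction (P<Q , after) ¬p
  go (yes _)       (yes _)        (no _)              = refl
  go (no _)        (no _)         (no _)              = refl
  go (no ¬p)       (yes (q , q′)) (no _)              = contradiction (q , inverted below q q′) ¬p
  go (yes (p , p′)) (no ¬q)       (no ¬h)             =
    contradiction (only p p′) λ { (inj₁ r) → ¬q (p , r) ; (inj₂ h) → ¬h h }
  pointwise : ∀ c d → χ (c F.<? d ×-dec y ⟨$⟩ʳ d F.<? y ⟨$⟩ʳ c) ≡
                      χ (c F.<? d ×-dec x ⟨$⟩ʳ d F.<? x ⟨$⟩ʳ c) + hit c d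
  pointwise c d = go (c F.<? d ×-dec y ⟨$⟩ʳ d F.<? y ⟨$⟩ʳ c)
                     (c F.<? d ×-dec x ⟨$⟩ʳ d F.<? x ⟨$⟩ʳ c) (c F.≟ P ×-dec d F.≟ Q)

-- The Coxeter length is the number of inversions

inject₁<suc : (i : Fin n) → inject₁ i < suc i
inject₁<suc i = s≤s (ℕ.≤-reflexive (F.toℕ-inject₁ i))

inject₁<⇒suc≤ : (i : Fin n) {y : Fin (suc n)} → inject₁ i < y → suc i F.≤ y
inject₁<⇒suc≤ i {y} p = subst (ℕ._≤ toℕ y) (cong suc (F.toℕ-inject₁ i)) p

<suc⇒≤inject₁ : (i : Fin n) {y : Fin (suc n)} → y < suc i → y F.≤ inject₁ i
<suc⇒≤inject₁ i {y} p = subst (toℕ y ℕ.≤_) (sym (F.toℕ-inject₁ i)) (s≤s⁻¹ p)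

≤∧≢⇒<ᶠ : {c d : Fin n} → c F.≤ d → c ≢ d → c < d
≤∧≢⇒<ᶠ p c≢d = ℕ.≤∧≢⇒< p (c≢d ∘ F.toℕ-injective)

s-left : (i : Fin n) → s {suc n} i ⟨$⟩ʳ inject₁ i ≡ suc i
s-left i rewrite dec-true (inject₁ i F.≟ inject₁ i) refl = refl

s-right : (i : Fin n) → s {suc n} i ⟨$⟩ʳ suc i ≡ inject₁ i
s-right i with suc i F.≟ inject₁ i
... | yes eq = eq
... | no _ rewrite dec-true (i F.≟ i) refl = refl

s-other : (i : Fin n) {y : Fin (suc n)} → y ≢ inject₁ i → y ≢ suc i → s {suc n} i ⟨$⟩ʳ y ≡ y
s-other i {y} p q rewrite dec-false (y F.≟ inject₁ i) p | dec-false (y F.≟ suc i) q = refl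

-- No value lies between `i` and `i + 1`, so exchanging them disturbs the order of this pair only.
s-monotone : (i : Fin n) {y y′ : Fin (suc n)} → y < y′ →
             s {suc n} i ⟨$⟩ʳ y < s {suc n} i ⟨$⟩ʳ y′ ⊎ (y ≡ inject₁ i × y′ ≡ suc i)
s-monotone {n} i {y} {y′} y<y′ = go (y F.≟ inject₁ i) (y F.≟ suc i) (y′ F.≟ inject₁ i) (y′ F.≟ suc i)
  where
  image : ∀ {u v} → s {suc n} i ⟨$⟩ʳ y ≡ u → s {suc n} i ⟨$⟩ʳ y′ ≡ v → u < v →
          s {suc n} i ⟨$⟩ʳ y < s {suc n} i ⟨$⟩ʳ y′ ⊎ (y ≡ inject₁ i × y′ ≡ suc i)
  image p q u<v = inj₁ (subst₂ _<_ (sym p) (sym q) u<v)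
  go : Dec (y ≡ inject₁ i) → Dec (y ≡ suc i) → Dec (y′ ≡ inject₁ i) → Dec (y′ ≡ suc i) →
       s {suc n} i ⟨$⟩ʳ y < s {suc n} i ⟨$⟩ʳ y′ ⊎ (y ≡ inject₁ i × y′ ≡ suc i)
  go (yes refl) _          (yes refl) _          = contradiction y<y′ (F.<-irrefl refl)
  go (yes refl) _          (no _)     (yes q′)   = inj₂ (refl , q′)
  go (yes refl) _          (no p′)    (no q′)    =
    image (s-left i) (s-other i p′ q′) (≤∧≢⇒<ᶠ (inject₁<⇒suc≤ i y<y′) (q′ ∘ sym))
  go (no _)     (yes refl) (yes refl) _          = contradiction y<y′ (F.<-asym (inject₁<suc i))
  go (no _)     (yes refl) (no _)     (yes refl) = contradiction y<y′ (F.<-irrefl refl)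
  go (no _)     (yes refl) (no p′)    (no q′)    =
    image (s-right i) (s-other i p′ q′) (F.<-trans (inject₁<suc i) y<y′)
  go (no p)     (no q)     (yes refl) _          =
    image (s-other i p q) (s-left i) (F.<-trans y<y′ (inject₁<suc i))
  go (no p)     (no q)     (no _)     (yes refl) =
    image (s-other i p q) (s-right i) (≤∧≢⇒<ᶠ (<suc⇒≤inject₁ i y<y′) p)
  go (no p)     (no q)     (no p′)    (no q′)    = image (s-other i p q) (s-other i p′ q′) y<y′

s-involutive : (i : Fin n) (y : Fin (suc n)) → s {suc n} i ⟨$⟩ˡ y ≡ s {suc n} i ⟨$⟩ʳ y
s-involutive {n} i y = trans (cong (s {suc n} i ⟨$⟩ˡ_) (sym (twice y))) (inverseˡ (s {suc n} i))
  where
  twice : ∀ y → s {suc n} i ⟨$⟩ʳ (s {suc n} i ⟨$⟩ʳ y) ≡ y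
  twice y = go (y F.≟ inject₁ i) (y F.≟ suc i)
    where
    go : Dec (y ≡ inject₁ i) → Dec (y ≡ suc i) → s {suc n} i ⟨$⟩ʳ (s {suc n} i ⟨$⟩ʳ y) ≡ y
    go (yes refl) _          = trans (cong (s {suc n} i ⟨$⟩ʳ_) (s-left i)) (s-right i)
    go (no _)     (yes refl) = trans (cong (s {suc n} i ⟨$⟩ʳ_) (s-right i)) (s-left i)
    go (no p)     (no q)     = trans (cong (s {suc n} i ⟨$⟩ʳ_) (s-other i p q)) (s-other i p q)

-- Left multiplication by `s i` exchanges the values `i` and `i + 1`, so the positions of these two
-- values form the only pair that becomes inverted.
s-cover : (x : S (suc n)) (i : Fin n) → x ⟨$⟩ˡ inject₁ i < x ⟨$⟩ˡ suc i →
          Cover x (s i · x) (x ⟨$⟩ˡ inject₁ i) (x ⟨$⟩ˡ suc i)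
s-cover {n} x i P<Q = record
  { P<Q = P<Q
  ; before = subst₂ _<_ (sym xP) (sym xQ) (inject₁<suc i)
  ; after = subst₂ _<_ (sym (trans (cong (s {suc n} i ⟨$⟩ʳ_) xQ) (s-right i)))
                       (sym (trans (cong (s {suc n} i ⟨$⟩ʳ_) xP) (s-left i))) (inject₁<suc i)
  ; below = ⊑-intro λ p q → case s-monotone i q of λ
      { (inj₁ r) → r
      ; (inj₂ (d≡ , c≡)) → contradiction p (F.<-asym (subst₂ _<_ (back d≡) (back c≡) P<Q)) }
  ; only = λ {c} {d} p q → case F.<-cmp (x ⟨$⟩ʳ c) (x ⟨$⟩ʳ d) of λ
      { (tri< r _ _) → case s-monotone i r of λ
          { (inj₁ r′) → contradiction q (F.<-asym r′)
          ; (inj₂ (c≡ , d≡)) → inj₂ (sym (back c≡) , sym (back d≡)) }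
      ; (tri≈ _ r _) → contradiction p (F.<-irrefl (perm-injective x r))
      ; (tri> _ _ r) → inj₁ r }
  }
  where
  xP : x ⟨$⟩ʳ (x ⟨$⟩ˡ inject₁ i) ≡ inject₁ i
  xP = inverseʳ x
  xQ : x ⟨$⟩ʳ (x ⟨$⟩ˡ suc i) ≡ suc i
  xQ = inverseʳ x
  back : ∀ {c y} → x ⟨$⟩ʳ c ≡ y → x ⟨$⟩ˡ y ≡ c
  back refl = inverseˡ x

s-cocover : (x : S (suc n)) (i : Fin n) → x ⟨$⟩ˡ suc i < x ⟨$⟩ˡ inject₁ i →
            Cover (s i · x) x (x ⟨$⟩ˡ suc i) (x ⟨$⟩ˡ inject₁ i)
s-cocover {n} x i P<Q = record
  { P<Q = P<Q
  ; before = subst₂ _<_ (sym (trans (cong (s {suc n} i ⟨$⟩ʳ_) xP) (s-right i)))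
                        (sym (trans (cong (s {suc n} i ⟨$⟩ʳ_) xQ) (s-left i))) (inject₁<suc i)
  ; after = subst₂ _<_ (sym xQ) (sym xP) (inject₁<suc i)
  ; below = ⊑-intro λ {c} {d} p q → case F.<-cmp (x ⟨$⟩ʳ c) (x ⟨$⟩ʳ d) of λ
      { (tri< r _ _) → case s-monotone i r of λ
          { (inj₁ r′) → contradiction q (F.<-asym r′)
          ; (inj₂ (c≡ , d≡)) → contradiction p (F.<-asym (subst₂ _<_ (back d≡) (back c≡) P<Q)) }
      ; (tri≈ _ r _) → contradiction p (F.<-irrefl (perm-injective x r))
      ; (tri> _ _ r) → r }
  ; only = λ p q → case s-monotone i q of λ
      { (inj₁ r) → inj₁ r
      ; (inj₂ (d≡ , c≡)) → inj₂ (sym (back c≡) , sym (back d≡)) }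
  }
  where
  xP : x ⟨$⟩ʳ (x ⟨$⟩ˡ suc i) ≡ suc i
  xP = inverseʳ x
  xQ : x ⟨$⟩ʳ (x ⟨$⟩ˡ inject₁ i) ≡ inject₁ i
  xQ = inverseʳ x
  back : ∀ {c y} → x ⟨$⟩ʳ c ≡ y → x ⟨$⟩ˡ y ≡ c
  back refl = inverseˡ x

inject₁≢suc : (w : S (suc n)) (i : Fin n) → w ⟨$⟩ˡ inject₁ i ≢ w ⟨$⟩ˡ suc i
inject₁≢suc w i eq = F.<-irrefl (perm-injective (w ⁻¹) eq) (inject₁<suc i)

-- A strictly increasing function dominates the identity; applied to w and to
-- its inverse this gives equality.
module _ {f : Fin n → Fin n} (f-mono : ∀ {c d} → c < d → f c < f d) where

  increasing⇒≤ : ∀ k (c : Fin n) → toℕ c ≡ k → k ≤ toℕ (f c)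
  increasing⇒≤ zero    c eq = z≤n
  increasing⇒≤ (suc k) c eq = ℕ.≤-<-trans (increasing⇒≤ k c′ (F.toℕ-fromℕ< k<n)) (f-mono c′<c)
    where
    k<n : k ℕ.< n
    k<n = ℕ.<-trans (ℕ.≤-reflexive (sym eq)) (F.toℕ<n c)
    c′ : Fin n
    c′ = fromℕ< k<n
    c′<c : c′ < c
    c′<c = subst₂ ℕ._<_ (sym (F.toℕ-fromℕ< k<n)) (sym eq) ℕ.≤-refl

increasing⇒id : (w : S n) → (∀ {c d} → c < d → w ⟨$⟩ʳ c < w ⟨$⟩ʳ d) → ∀ c → w ⟨$⟩ʳ c ≡ c
increasing⇒id w mono c = F.toℕ-injective (ℕ.≤-antisym
  (subst (toℕ (w ⟨$⟩ʳ c) ≤_) (cong toℕ (inverseˡ w)) (increasing⇒≤ mono⁻¹ _ (w ⟨$⟩ʳ c) refl))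
  (increasing⇒≤ mono _ c refl))
  where
  mono⁻¹ : ∀ {c d} → c < d → w ⟨$⟩ˡ c < w ⟨$⟩ˡ d
  mono⁻¹ {c} {d} c<d with F.<-cmp (w ⟨$⟩ˡ c) (w ⟨$⟩ˡ d)
  ... | tri< r _ _ = r
  ... | tri≈ _ r _ = contradiction c<d (F.<-irrefl (perm-injective (w ⁻¹) r))
  ... | tri> _ _ r = contradiction c<d (F.<-asym (subst₂ _<_ (inverseʳ w) (inverseʳ w) (mono r)))

locally-increasing : (f : Fin (suc n) → Fin (suc n)) → (∀ i → f (inject₁ i) < f (suc i)) →
                     ∀ {c d} → c < d → f c < f d
locally-increasing {n} f loc {c} {d} = go (toℕ d) d refl
  where
  go : ∀ k d → toℕ d ≡ k → c < d → f c < f d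
  go (suc k) (suc d) eq c<d with c F.≟ inject₁ d
  ... | yes refl = loc d
  ... | no c≢d   = F.<-trans (go k (inject₁ d) (trans (F.toℕ-inject₁ d) (ℕ.suc-injective eq))
                                 (≤∧≢⇒<ᶠ (<suc⇒≤inject₁ d c<d) c≢d)) (loc d)

inv-s : (x : S (suc n)) (i : Fin n) →
        (x ⟨$⟩ˡ inject₁ i < x ⟨$⟩ˡ suc i × inv (s i · x) ≡ suc (inv x)) ⊎
        (x ⟨$⟩ˡ suc i < x ⟨$⟩ˡ inject₁ i × inv x ≡ suc (inv (s i · x)))
inv-s x i with F.<-cmp (x ⟨$⟩ˡ inject₁ i) (x ⟨$⟩ˡ suc i)
... | tri< p _ _ = inj₁ (p , inv-cover (s-cover x i p))
... | tri≈ _ p _ = contradiction p (inject₁≢suc x i)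
... | tri> _ _ p = inj₂ (p , inv-cover (s-cocover x i p))

inv-e : inv (e {n}) ≡ 0
inv-e {n} = sum-zero {n} _ λ c → sum-zero {n} _ λ d →
  χ-false (c F.<? d ×-dec d F.<? c) λ (p , q) → F.<-asym p q

-- By `inv-s`, each letter adds at most one inversion.
word⇒inv≤ : (w : S (suc n)) → ∀ {k} → HasWord w k → inv w ≤ k
word⇒inv≤ {n} w {k} (is , p) = subst (_≤ k) (inv-resp (prod is) w p) (go is)
  where
  go : ∀ {k} is → inv (prod {suc n} {k} is) ≤ k
  go []       = ℕ.≤-reflexive (inv-e {suc n})
  go (i ∷ is) with inv-s (prod is) i
  ... | inj₁ (_ , eq) = ℕ.≤-trans (ℕ.≤-reflexive eq) (s≤s (go is))
  ... | inj₂ (_ , eq) = ℕ.≤-trans (ℕ.n≤1+n _) (ℕ.≤-trans (ℕ.≤-reflexive (sym eq)) (ℕ.m≤n⇒m≤1+n (go is)))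

-- As long as some value `i + 1` stands left of `i`, multiplying by `s i` removes one inversion.
-- When there is no such `i`, the inverse of `w` is increasing and `w` is the identity.
inv-word : ∀ k (w : S (suc n)) → inv w ≡ k → ∃[ j ] j ≤ k × HasWord w j
inv-word {n} k w eq with F.any? (λ i → w ⟨$⟩ˡ suc i F.<? w ⟨$⟩ˡ inject₁ i)
... | no none = 0 , z≤n , [] , λ c → perm-injective (w ⁻¹) (trans (fix c) (sym (inverseˡ w)))
  where
  loc : ∀ i → w ⟨$⟩ˡ inject₁ i < w ⟨$⟩ˡ suc i
  loc i = not-inverted (w ⁻¹) (inject₁<suc i) λ p → none (i , p)
  fix : ∀ c → w ⟨$⟩ˡ c ≡ c
  fix = increasing⇒id (w ⁻¹) (locally-increasing (w ⟨$⟩ˡ_) loc)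
inv-word {n} k w eq | yes (i , p) with k | trans (sym eq) (inv-cover (s-cocover w i p))
... | suc k | eq′ with inv-word k (s i · w) (sym (ℕ.suc-injective eq′))
...   | j , j≤k , is , q = suc j , s≤s j≤k , i ∷ is , λ c →
          trans (cong (s {suc n} i ⟨$⟩ʳ_) (q c))
            (trans (sym (s-involutive i (s {suc n} i ⟨$⟩ʳ (w ⟨$⟩ʳ c)))) (inverseˡ (s {suc n} i)))

ℓ≡inv : (w : S (suc n)) → ℓ w ≡ inv w
ℓ≡inv w = ℕ.≤-antisym ℓ≤inv (word⇒inv≤ w (ℓ-hasWord w))
  where
  ℓ≤inv : ℓ w ≤ inv w
  ℓ≤inv = let (j , j≤k , word) = inv-word (inv w) w refl in ℕ.≤-trans (ℓ-minimal w j word) j≤k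

≤L⇒⊑ : (x y : S (suc n)) → x ≤L y → x ⊑ y
≤L⇒⊑ x y p = proj₂ (⊑⇔inv x y)
  (trans (sym (cong₂ _+_ (ℓ≡inv (y · x ⁻¹)) (ℓ≡inv x))) (trans p (ℓ≡inv y)))

⊑⇒≤L : (x y : S (suc n)) → x ⊑ y → x ≤L y
⊑⇒≤L x y p =
  trans (cong₂ _+_ (ℓ≡inv (y · x ⁻¹)) (ℓ≡inv x)) (trans (proj₁ (⊑⇔inv x y) p) (sym (ℓ≡inv y)))

-- Right descents as adjacent inversions

Descent : S (suc n) → Fin n → Set
Descent w i = w ⟨$⟩ʳ suc i < w ⟨$⟩ʳ inject₁ i

Descent? : (w : S (suc n)) (i : Fin n) → Dec (Descent w i)
Descent? w i = w ⟨$⟩ʳ suc i F.<? w ⟨$⟩ʳ inject₁ i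

-- Taking inverses turns right multiplication by `s i` into left multiplication, so that the covers
-- above apply to `w ⁻¹`.
inv-·s : (w : S (suc n)) (i : Fin n) → inv (w · s i) ≡ inv (s i · w ⁻¹)
inv-·s {n} w i = trans (sym (inv-⁻¹ (w · s i)))
  (inv-resp ((w · s i) ⁻¹) (s i · w ⁻¹) λ c → s-involutive i (w ⟨$⟩ˡ c))

ℓ-·s : (w : S (suc n)) (i : Fin n) → ℓ (w · s i) ≡ inv (s i · w ⁻¹)
ℓ-·s w i = trans (ℓ≡inv (w · s i)) (inv-·s w i)

ℓ-⁻¹ : (w : S (suc n)) → ℓ w ≡ inv (w ⁻¹)
ℓ-⁻¹ w = trans (ℓ≡inv w) (sym (inv-⁻¹ w))

descent⇒ℓ< : (w : S (suc n)) (i : Fin n) → Descent w i → ℓ (w · s i) ℕ.< ℓ w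
descent⇒ℓ< w i p = ℕ.≤-reflexive
  (trans (cong suc (ℓ-·s w i)) (trans (sym (inv-cover (s-cocover (w ⁻¹) i p))) (sym (ℓ-⁻¹ w))))

ℓ<⇒descent : (w : S (suc n)) (i : Fin n) → ℓ (w · s i) ℕ.< ℓ w → Descent w i
ℓ<⇒descent w i lt = case inv-s (w ⁻¹) i of λ
  { (inj₂ (p , _))  → p
  ; (inj₁ (_ , eq)) → contradiction lt (ℕ.<-asym (ℕ.≤-reflexive
      (trans (cong suc (ℓ-⁻¹ w)) (trans (sym eq) (sym (ℓ-·s w i)))))) }

does⇒ : {P : Set} (P? : Dec P) → does P? ≡ true → P
does⇒ (yes p) _ = p

lookup-D_R : (w : S (suc n)) (i : Fin n) → lookup (D_R w) i ≡ does (ℓ (w · s i) ℕ.<? ℓ w)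
lookup-D_R w i = lookup∘tabulate (λ i → does (ℓ (w · s i) ℕ.<? ℓ w)) i

∈D_R⇒descent : (w : S (suc n)) (i : Fin n) → i ∈ D_R w → Descent w i
∈D_R⇒descent w i i∈ = ℓ<⇒descent w i
  (does⇒ (ℓ (w · s i) ℕ.<? ℓ w) (trans (sym (lookup-D_R w i)) ([]=⇒lookup i∈)))

descent⇒∈D_R : (w : S (suc n)) (i : Fin n) → Descent w i → i ∈ D_R w
descent⇒∈D_R w i p = lookup⇒[]= i (D_R w)
  (trans (lookup-D_R w i) (dec-true (ℓ (w · s i) ℕ.<? ℓ w) (descent⇒ℓ< w i p)))

-- Sorting permutations and the descent congruence

-- Pigeonhole: if `y` were missed, punching it out would give an injection into a smaller finite
-- set.
injective⇒surjective : {f : Fin n → Fin n} → Injective _≡_ _≡_ f → ∀ y → ∃[ c ] f c ≡ y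
injective⇒surjective {suc n} {f} f-inj y with F.any? (λ c → f c F.≟ y)
... | yes hit = hit
... | no miss = contradiction
  (F.injective⇒≤ {f = λ c → punchOut (avoids c)}
     (λ {c} {d} eq → f-inj (F.punchOut-injective (avoids c) (avoids d) eq))) ℕ.1+n≰n
  where
  avoids : ∀ c → y ≢ f c
  avoids c eq = miss (c , sym eq)

-- The positions are ranked by key, ties being broken by position.
module _ (key : Fin n → ℕ) where

  private
    _≺_ : Fin n → Fin n → Set
    c ≺ d = key c ℕ.< key d ⊎ (key c ≡ key d × c < d)

    _≺?_ : ∀ c d → Dec (c ≺ d)
    c ≺? d = key c ℕ.<? key d ⊎-dec (key c ℕ.≟ key d ×-dec c F.<? d)

    ≺-irrefl : ∀ c → ¬ (c ≺ c)
    ≺-irrefl c (inj₁ p)       = ℕ.<-irrefl refl p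
    ≺-irrefl c (inj₂ (_ , p)) = F.<-irrefl refl p

    ≺-trans : ∀ {c d f} → c ≺ d → d ≺ f → c ≺ f
    ≺-trans (inj₁ p)        (inj₁ q)        = inj₁ (ℕ.<-trans p q)
    ≺-trans (inj₁ p)        (inj₂ (eq , _)) = inj₁ (ℕ.<-≤-trans p (ℕ.≤-reflexive eq))
    ≺-trans (inj₂ (eq , _)) (inj₁ q)        = inj₁ (ℕ.≤-<-trans (ℕ.≤-reflexive eq) q)
    ≺-trans (inj₂ (eq , p)) (inj₂ (eq′ , q)) = inj₂ (trans eq eq′ , F.<-trans p q)

    ≺-total : ∀ {c d} → c ≢ d → c ≺ d ⊎ d ≺ c
    ≺-total {c} {d} c≢d with ℕ.<-cmp (key c) (key d) | F.<-cmp c d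
    ... | tri< p _ _  | _           = inj₁ (inj₁ p)
    ... | tri> _ _ p  | _           = inj₂ (inj₁ p)
    ... | tri≈ _ eq _ | tri< p _ _  = inj₁ (inj₂ (eq , p))
    ... | tri≈ _ eq _ | tri≈ _ p _  = contradiction p c≢d
    ... | tri≈ _ eq _ | tri> _ _ p  = inj₂ (inj₂ (sym eq , p))

    below : Fin n → Subset n
    below c = tabulate λ d → does (d ≺? c)

    ∈below⇒ : ∀ {c d} → d ∈ below c → d ≺ c
    ∈below⇒ {c} {d} d∈ = does⇒ (d ≺? c) (trans (sym (lookup∘tabulate _ d)) ([]=⇒lookup d∈))

    ⇒∈below : ∀ {c d} → d ≺ c → d ∈ below c
    ⇒∈below {c} {d} p = lookup⇒[]= d _ (trans (lookup∘tabulate _ d) (dec-true (d ≺? c) p))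

    rank : Fin n → ℕ
    rank c = ∣ below c ∣

    rank-mono : ∀ {c d} → c ≺ d → rank c ℕ.< rank d
    rank-mono {c} p = p⊂q⇒∣p∣<∣q∣
      ((λ q → ⇒∈below (≺-trans (∈below⇒ q) p)) , c , ⇒∈below p , λ c∈ → ≺-irrefl c (∈below⇒ c∈))

    rank<n : ∀ c → rank c ℕ.< n
    rank<n c = subst (rank c ℕ.<_) (∣⊤∣≡n n)
      (p⊂q⇒∣p∣<∣q∣ ((λ _ → ∈⊤) , c , ∈⊤ , λ c∈ → ≺-irrefl c (∈below⇒ c∈)))

    place : Fin n → Fin n
    place c = fromℕ< (rank<n c)

    place-mono : ∀ {c d} → c ≺ d → place c < place d
    place-mono {c} {d} p = subst₂ ℕ._<_ (sym (F.toℕ-fromℕ< (rank<n c))) (sym (F.toℕ-fromℕ< (rank<n d))) (rank-mono p)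

    place-injective : Injective _≡_ _≡_ place
    place-injective {c} {d} eq with c F.≟ d
    ... | yes c≡d = c≡d
    ... | no c≢d with ≺-total c≢d
    ...   | inj₁ p = contradiction (place-mono p) (F.<-irrefl eq)
    ...   | inj₂ p = contradiction (place-mono p) (F.<-irrefl (sym eq))

    unplace : ∀ y → ∃[ c ] place c ≡ y
    unplace = injective⇒surjective place-injective

  abstract

    -- Since ties keep their order, the inversions of `std` are exactly the strict drops of `key`.
    -- Only this is used later, so the construction is kept opaque.
    std : S n
    std = permutation place (proj₁ ∘ unplace) (proj₂ ∘ unplace) (λ c → place-injective (proj₂ (unplace (place c))))

    std-inverts : ∀ {c d} → key d ℕ.< key c → std ⟨$⟩ʳ d < std ⟨$⟩ʳ c
    std-inverts p = place-mono (inj₁ p)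

    std-inverted : ∀ {c d} → c < d → std ⟨$⟩ʳ d < std ⟨$⟩ʳ c → key d ℕ.< key c
    std-inverted {c} {d} c<d p with ℕ.<-cmp (key d) (key c)
    ... | tri< q _ _  = q
    ... | tri≈ _ eq _ = contradiction p (F.<-asym (place-mono (inj₂ (sym eq , c<d))))
    ... | tri> _ _ q  = contradiction p (F.<-asym (place-mono (inj₁ q)))

-- Atoms and coatoms

opposite-anti : {c d : Fin n} → c < d → opposite d < opposite c
opposite-anti {n} {c} {d} p = subst₂ ℕ._<_ (sym (F.opposite-prop d)) (sym (F.opposite-prop c))
  (ℕ.∸-monoʳ-< (s≤s p) (F.toℕ<n d))

-- The factor `e` makes this literally the upper element of `s-cover e i`.
atom : Fin n → S (suc n)
atom i = s i · e

-- The atom has a single inversion, the adjacent pair of positions `i`, `i + 1`.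
atom⊑ : {x : S (suc n)} (i : Fin n) → Descent x i → atom i ⊑ x
atom⊑ i desc .inverted p q with Cover.only (s-cover e i (inject₁<suc i)) p q
... | inj₁ r = contradiction p (F.<-asym r)
... | inj₂ (refl , refl) = desc

atom-descent : (i : Fin n) → Descent (atom i) i
atom-descent i = Cover.after (s-cover e i (inject₁<suc i))

-- The longest element inverts all pairs of positions; composing it with `s i` restores the order at
-- `i`, `i + 1` alone.
coatom : Fin n → S (suc n)
coatom i = reverse · s i

⊑coatom : {x : S (suc n)} (i : Fin n) → ¬ Descent x i → x ⊑ coatom i
⊑coatom i ¬desc .inverted p q with s-monotone i p
... | inj₁ r = opposite-anti r
... | inj₂ (refl , refl) = contradiction q ¬desc

coatom-ascent : (i : Fin n) → ¬ Descent (coatom i) i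
coatom-ascent i p = F.<-asym p
  (subst₂ _<_ (cong opposite (sym (s-left i))) (cong opposite (sym (s-right i))) (opposite-anti (inject₁<suc i)))

SameDescents : (x y : S (suc n)) → Set
SameDescents x y = ∀ i → (Descent x i → Descent y i) × (Descent y i → Descent x i)

≤L⇒descent : (x y : S (suc n)) → x ≤L y → ∀ i → Descent x i → Descent y i
≤L⇒descent x y x≤y i = inverted (≤L⇒⊑ x y x≤y) (inject₁<suc i)

-- The atom of a common descent is a common lower bound, hence lies below the meet.
meet-descent : (x y m : S (suc n)) → IsMeet x y m → ∀ i → Descent x i → Descent y i → Descent m i
meet-descent x y m (_ , _ , greatest) i dx dy = ≤L⇒descent (atom i) m
  (greatest (atom i) (⊑⇒≤L (atom i) x (atom⊑ i dx)) (⊑⇒≤L (atom i) y (atom⊑ i dy))) i (atom-descent i)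

-- Dually, the coatom of a common ascent is a common upper bound, hence lies above the join.
join-descent : (x y j : S (suc n)) → IsJoin x y j → ∀ i → Descent j i → Descent x i ⊎ Descent y i
join-descent {n} x y j (_ , _ , smallest) i dj = go (Descent? x i) (Descent? y i)
  where
  go : Dec (Descent x i) → Dec (Descent y i) → Descent x i ⊎ Descent y i
  go (yes dx) _        = inj₁ dx
  go (no _)   (yes dy) = inj₂ dy
  go (no ¬dx) (no ¬dy) = contradiction (≤L⇒descent j (coatom i) j≤ i dj) (coatom-ascent i)
    where
    j≤ : j ≤L coatom i
    j≤ = smallest (coatom i) (⊑⇒≤L x (coatom i) (⊑coatom i ¬dx)) (⊑⇒≤L y (coatom i) (⊑coatom i ¬dy))

-- The map `D_R` sends meets to intersections and joins to unions, so it is a lattice homomorphism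
-- onto its image in a Boolean lattice, and this congruence is its kernel.
descentCongruence : ∀ n → LatticeCongruence (suc n)
descentCongruence n = record
  { _∼_ = SameDescents
  ; isEquivalence = record
      { refl  = λ i → (λ p → p) , λ p → p
      ; sym   = λ x∼y i → swap (x∼y i)
      ; trans = λ x∼y y∼z i → proj₁ (y∼z i) ∘ proj₁ (x∼y i) , proj₂ (x∼y i) ∘ proj₂ (y∼z i) }
  ; ≈⇒∼ = λ x≈y i → subst₂ _<_ (x≈y (suc i)) (x≈y (inject₁ i)) ,
                    subst₂ _<_ (sym (x≈y (suc i))) (sym (x≈y (inject₁ i)))
  ; ∧-cong = λ {x₁} {x₂} {y₁} {y₂} {m₁} {m₂} x∼ y∼ p q i →
      meet⊆ x₁ x₂ y₁ y₂ m₁ m₂ x∼ y∼ p q i ,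
      meet⊆ x₂ x₁ y₂ y₁ m₂ m₁ (λ j → swap (x∼ j)) (λ j → swap (y∼ j)) q p i
  ; ∨-cong = λ {x₁} {x₂} {y₁} {y₂} {j₁} {j₂} x∼ y∼ p q i →
      join⊆ x₁ x₂ y₁ y₂ j₁ j₂ x∼ y∼ p q i ,
      join⊆ x₂ x₁ y₂ y₁ j₂ j₁ (λ j → swap (x∼ j)) (λ j → swap (y∼ j)) q p i
  }
  where
  meet⊆ : ∀ x₁ x₂ y₁ y₂ m₁ m₂ → SameDescents x₁ x₂ → SameDescents y₁ y₂ →
          IsMeet x₁ y₁ m₁ → IsMeet x₂ y₂ m₂ → ∀ i → Descent {n} m₁ i → Descent m₂ i
  meet⊆ x₁ x₂ y₁ y₂ m₁ m₂ x∼ y∼ (m≤x , m≤y , _) isMeet i d =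
    meet-descent x₂ y₂ m₂ isMeet i (proj₁ (x∼ i) (≤L⇒descent m₁ x₁ m≤x i d))
                                   (proj₁ (y∼ i) (≤L⇒descent m₁ y₁ m≤y i d))
  join⊆ : ∀ x₁ x₂ y₁ y₂ j₁ j₂ → SameDescents x₁ x₂ → SameDescents y₁ y₂ →
          IsJoin x₁ y₁ j₁ → IsJoin x₂ y₂ j₂ → ∀ i → Descent {n} j₁ i → Descent j₂ i
  join⊆ x₁ x₂ y₁ y₂ j₁ j₂ x∼ y∼ isJoin (x≤j , y≤j , _) i d =
    case join-descent x₁ y₁ j₁ isJoin i d of λ
      { (inj₁ dx) → ≤L⇒descent x₂ j₂ x≤j i (proj₁ (x∼ i) dx)
      ; (inj₂ dy) → ≤L⇒descent y₂ j₂ y≤j i (proj₁ (y∼ i) dy) }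

descentCongruence-essential : ∀ n → Essential (descentCongruence n)
descentCongruence-essential n w w∼e = increasing⇒id w (locally-increasing (w ⟨$⟩ʳ_) λ i →
  not-inverted w (inject₁<suc i) λ p → F.<-asym (proj₁ (w∼e i) p) (inject₁<suc i))

-- The extremal pair: in one-line notation u = 1 32 4 65 7 …, the minimum of its
-- descent class, and w is the maximum of this class, with increasing runs at
-- the positions 12, 345, 678, ….

τ : Fin n → Fin n
τ {1}                 c                   = c
τ {2}                 c                   = c
τ {suc (suc (suc n))} zero                = zero
τ {suc (suc (suc n))} (suc zero)          = suc (suc zero)
τ {suc (suc (suc n))} (suc (suc zero))    = suc zero
τ {suc (suc (suc n))} (suc (suc (suc c))) = suc (suc (suc (τ c)))

τ-involutive : (c : Fin n) → τ (τ c) ≡ c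
τ-involutive {1}                 c                   = refl
τ-involutive {2}                 c                   = refl
τ-involutive {suc (suc (suc n))} zero                = refl
τ-involutive {suc (suc (suc n))} (suc zero)          = refl
τ-involutive {suc (suc (suc n))} (suc (suc zero))    = refl
τ-involutive {suc (suc (suc n))} (suc (suc (suc c))) = cong (λ d → suc (suc (suc d))) (τ-involutive c)

run : ℕ → ℕ
run 0                   = 0
run 1                   = 0
run 2                   = 1
run (suc (suc (suc c))) = suc (run c)

-- This bound keeps the truncated subtraction in `wₙ` strictly decreasing in the run number.
run≤ : ∀ c → run c ≤ c
run≤ 0                   = z≤n
run≤ 1                   = z≤n
run≤ 2                   = s≤s z≤n
run≤ (suc (suc (suc c))) = s≤s (ℕ.m≤n⇒m≤o+n 2 (run≤ c))

-- `τ` exchanges the last position of each run with the first position of the next run and fixes the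
-- rest, so it inverts only adjacent positions at a run boundary.
τ-inverted : {c d : Fin n} → c < d → τ d < τ c → toℕ d ≡ suc (toℕ c) × run (toℕ c) ℕ.< run (toℕ d)
τ-inverted {1} p q = contradiction q (F.<-asym p)
τ-inverted {2} p q = contradiction q (F.<-asym p)
τ-inverted {suc (suc (suc n))} {suc zero}          {suc (suc zero)}    p q = refl , s≤s z≤n
τ-inverted {suc (suc (suc n))} {suc zero}          {suc (suc (suc d))} p (s≤s (s≤s ()))
τ-inverted {suc (suc (suc n))} {suc (suc zero)}    {suc (suc zero)}    (s≤s (s≤s ())) q
τ-inverted {suc (suc (suc n))} {suc (suc zero)}    {suc (suc (suc d))} p (s≤s ())
τ-inverted {suc (suc (suc n))} {suc (suc (suc c))} {suc (suc (suc d))} (s≤s (s≤s (s≤s p))) (s≤s (s≤s (s≤s q)))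
  with τ-inverted p q
... | eq , r = cong (3 +_) eq , s≤s r
τ-inverted {suc (suc (suc n))} {suc zero}          {suc zero}          (s≤s ()) q
τ-inverted {suc (suc (suc n))} {suc (suc c)}       {suc zero}          (s≤s ()) q
τ-inverted {suc (suc (suc n))} {suc (suc (suc c))} {suc (suc zero)}    (s≤s (s≤s ())) q
τ-inverted {suc (suc (suc n))} {zero}              {d}                 p ()

run-step⇒τ-inverted : {c d : Fin n} → toℕ d ≡ suc (toℕ c) → run (toℕ c) ℕ.< run (toℕ d) → τ d < τ c
run-step⇒τ-inverted {1} {zero} {zero} () _
run-step⇒τ-inverted {2} {zero} {suc zero} _ ()
run-step⇒τ-inverted {2} {suc zero} {zero} () _
run-step⇒τ-inverted {2} {suc zero} {suc zero} () _
run-step⇒τ-inverted {2} {zero} {zero} () _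
run-step⇒τ-inverted {suc (suc (suc n))} {zero}              {suc zero}             _  ()
run-step⇒τ-inverted {suc (suc (suc n))} {suc zero}          {suc (suc zero)}       _  _ = s≤s (s≤s z≤n)
run-step⇒τ-inverted {suc (suc (suc n))} {suc (suc zero)}    {suc (suc (suc zero))} _  (s≤s ())
run-step⇒τ-inverted {suc (suc (suc n))} {suc (suc (suc c))} {suc (suc (suc d))}    eq (s≤s r) =
  s≤s (s≤s (s≤s (run-step⇒τ-inverted (ℕ.suc-injective (ℕ.suc-injective (ℕ.suc-injective eq))) r)))

uₙ : ∀ n → S n
uₙ n = permutation τ τ τ-involutive τ-involutive

wₙ : ∀ n → S n
wₙ n = std λ c → n ∸ run (toℕ c)

wₙ-inverts : {c d : Fin n} → run (toℕ c) ℕ.< run (toℕ d) → wₙ n ⟨$⟩ʳ d < wₙ n ⟨$⟩ʳ c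
wₙ-inverts {n} {c} {d} p = std-inverts (λ c → n ∸ run (toℕ c)) {c} {d}
  (ℕ.∸-monoʳ-< p (ℕ.≤-trans (run≤ (toℕ d)) (ℕ.<⇒≤ (F.toℕ<n d))))

wₙ-descent : (i : Fin n) → Descent (wₙ (suc n)) i → run (toℕ (inject₁ i)) ℕ.< run (toℕ (suc i))
wₙ-descent {n} i p = ℕ.≰⇒> λ le → ℕ.<⇒≱ (std-inverted (λ c → suc n ∸ run (toℕ c)) (inject₁<suc i) p)
                                        (ℕ.∸-monoʳ-≤ (suc n) le)

-- All inversions of `uₙ` are adjacent, and they sit at the descents of `wₙ`. Every member of the
-- class has these descents, so its inversion set contains that of `uₙ`.
uₙ-minimal : ∀ n → π↓[ descentCongruence n ] wₙ (suc n) ↦ uₙ (suc n)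
uₙ-minimal n = (λ i → to i , from i) , λ v v∼w → ⊑⇒≤L (uₙ (suc n)) v (least-in-class v v∼w)
  where
  to : ∀ i → Descent (uₙ (suc n)) i → Descent (wₙ (suc n)) i
  to i p = wₙ-inverts (proj₂ (τ-inverted (inject₁<suc i) p))
  from : ∀ i → Descent (wₙ (suc n)) i → Descent (uₙ (suc n)) i
  from i p = run-step⇒τ-inverted {c = inject₁ i} {suc i} (cong suc (sym (F.toℕ-inject₁ i))) (wₙ-descent i p)
  least-in-class : ∀ v → SameDescents v (wₙ (suc n)) → uₙ (suc n) ⊑ v
  least-in-class v v∼w .inverted {c} {suc d} p q with τ-inverted {c = c} {suc d} p q
  ... | eq , r with F.toℕ-injective {i = c} {inject₁ d} (trans (sym (ℕ.suc-injective eq)) (sym (F.toℕ-inject₁ d)))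
  ... | refl = proj₂ (v∼w d) (wₙ-inverts r)

-- Indices i, counted from 0, with i ≡ 2 mod 3, or i ≡ 0 mod 3 and i + 1 < n.
attained : ∀ n → Subset n
attained 0                   = []
attained 1                   = outside ∷ []
attained 2                   = inside ∷ outside ∷ []
attained (suc (suc (suc n))) = inside ∷ outside ∷ inside ∷ attained n

∣attained∣ : ∀ n → ∣ attained n ∣ ≡ 2 * n / 3
∣attained∣ 0 = refl
∣attained∣ 1 = refl
∣attained∣ 2 = refl
∣attained∣ (suc (suc (suc n))) = trans (cong (2 +_) (∣attained∣ n))
  (trans (sym (+-distrib-/-∣ˡ {6} (2 * n) {3} (divides 2 refl))) (cong (_/ 3) (sym (ℕ.*-distribˡ-+ 2 3 n))))

-- As `τ` is its own inverse, `wₙ · uₙ ⁻¹` sends `i` to the value of `wₙ` at `τ i`, and `wₙ` drops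
-- whenever the run number grows.
attained-run : (i : Fin n) → i ∈ attained n → run (toℕ (τ (inject₁ i))) ℕ.< run (toℕ (τ (suc i)))
attained-run {2}                 zero       here = s≤s z≤n
attained-run {2}                 (suc zero) (there ())
attained-run {suc (suc (suc n))} zero       here = s≤s z≤n
attained-run {suc (suc (suc n))} (suc (suc zero)) (there (there here)) = s≤s z≤n
attained-run {suc (suc (suc n))} (suc (suc (suc i))) (there (there (there i∈))) = s≤s (attained-run i i∈)

attained⊆D_R : ∀ n → attained n ⊆ D_R (wₙ (suc n) · uₙ (suc n) ⁻¹)
attained⊆D_R n {i} i∈ = descent⇒∈D_R (wₙ (suc n) · uₙ (suc n) ⁻¹) i (wₙ-inverts {c = τ (inject₁ i)} {τ (suc i)} (attained-run i i∈))

2n/3≤∣D_R∣ : ∀ n → 2 * n / 3 ≤ ∣ D_R (wₙ (suc n) · uₙ (suc n) ⁻¹) ∣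
2n/3≤∣D_R∣ n = subst (_≤ ∣ D_R (wₙ (suc n) · uₙ (suc n) ⁻¹) ∣) (∣attained∣ n) (p⊆q⇒∣p∣≤∣q∣ (attained⊆D_R n))

-- Forcing between arcs

isMeet : (x y m : S (suc n)) → m ⊑ x → m ⊑ y → (∀ z → z ⊑ x → z ⊑ y → z ⊑ m) → IsMeet x y m
isMeet x y m m⊑x m⊑y greatest =
  ⊑⇒≤L m x m⊑x , ⊑⇒≤L m y m⊑y , λ z p q → ⊑⇒≤L z m (greatest z (≤L⇒⊑ z x p) (≤L⇒⊑ z y q))

isJoin : (x y j : S (suc n)) → x ⊑ j → y ⊑ j → (∀ z → x ⊑ z → y ⊑ z → j ⊑ z) → IsJoin x y j
isJoin x y j x⊑j y⊑j smallest =
  ⊑⇒≤L x j x⊑j , ⊑⇒≤L y j y⊑j , λ z p q → ⊑⇒≤L j z (smallest z (≤L⇒⊑ x z p) (≤L⇒⊑ y z q))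

-- Positions c are classified relative to P ≤ a < b ≤ Q, where (P, Q) is a falling
-- and (a, b) a contracted rising arc of u: c is low or high according to whether
-- it lies below or above the arc (P, Q), with the positions left of P counted as
-- low and those right of Q as high, and the index 1, 2, 3 says whether c < a,
-- a < c < b or b < c.  If P = a or Q = b, the kinds at-a and at-b take precedence.
-- A key assigns to each kind a height and stands for the permutation that sorts
-- the positions by height and then from left to right; inclusions between the
-- inversion sets of such permutations become finite checks on pairs of kinds.
Kind : Set
Kind = Fin 10

Key : Set
Key = Vec ℕ 10

pattern lo₁ = zero
pattern hi₁ = suc zero
pattern at-P = suc (suc zero)
pattern at-a = suc (suc (suc zero))
pattern lo₂ = suc (suc (suc (suc zero)))
pattern hi₂ = suc (suc (suc (suc (suc zero))))
pattern at-b = suc (suc (suc (suc (suc (suc zero)))))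
pattern at-Q = suc (suc (suc (suc (suc (suc (suc zero))))))
pattern lo₃ = suc (suc (suc (suc (suc (suc (suc (suc zero)))))))
pattern hi₃ = suc (suc (suc (suc (suc (suc (suc (suc (suc zero))))))))

--                lo₁ hi₁ P   a   lo₂ hi₂ b   Q   lo₃ hi₃
zones J∗ J F G M↑ H↑ M↓ H↓ : Key
zones = 0 ∷ 0 ∷ 0 ∷ 1 ∷ 2 ∷ 2 ∷ 3 ∷ 4 ∷ 4 ∷ 4 ∷ []
J∗    = 0 ∷ 0 ∷ 0 ∷ 1 ∷ 0 ∷ 3 ∷ 2 ∷ 3 ∷ 3 ∷ 3 ∷ []
J     = 0 ∷ 0 ∷ 0 ∷ 2 ∷ 0 ∷ 3 ∷ 1 ∷ 3 ∷ 3 ∷ 3 ∷ []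
F     = 0 ∷ 5 ∷ 2 ∷ 1 ∷ 0 ∷ 5 ∷ 4 ∷ 3 ∷ 0 ∷ 5 ∷ []
G     = 0 ∷ 5 ∷ 4 ∷ 3 ∷ 0 ∷ 5 ∷ 2 ∷ 1 ∷ 0 ∷ 5 ∷ []
M↑    = 0 ∷ 1 ∷ 1 ∷ 0 ∷ 0 ∷ 1 ∷ 0 ∷ 0 ∷ 0 ∷ 1 ∷ []
H↑    = 0 ∷ 3 ∷ 1 ∷ 0 ∷ 0 ∷ 3 ∷ 2 ∷ 2 ∷ 2 ∷ 3 ∷ []
M↓    = 0 ∷ 1 ∷ 1 ∷ 1 ∷ 0 ∷ 1 ∷ 1 ∷ 0 ∷ 0 ∷ 1 ∷ []
H↓    = 0 ∷ 1 ∷ 1 ∷ 1 ∷ 0 ∷ 3 ∷ 3 ∷ 2 ∷ 0 ∷ 3 ∷ []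

Drops : Key → Kind → Kind → Set
Drops X k l = lookup X l ℕ.< lookup X k

drops? : ∀ X k l → Dec (Drops X k l)
drops? X k l = lookup X l ℕ.<? lookup X k

-- Zones increase from left to right, so other pairs of kinds never occur at c < d.
Inverts : Key → Kind → Kind → Set
Inverts X k l = lookup zones k ≤ lookup zones l × Drops X k l

inverts? : ∀ X k l → Dec (Inverts X k l)
inverts? X k l = lookup zones k ℕ.≤? lookup zones l ×-dec drops? X k l

all-kinds : {R : Kind → Kind → Set} → (∀ k l → Dec (R k l)) → Dec (∀ k l → R k l)
all-kinds R? = F.all? λ k → F.all? λ l → R? k l

is? : (k₀ l₀ k l : Kind) → Dec (k ≡ k₀ × l ≡ l₀)
is? k₀ l₀ k l = k F.≟ k₀ ×-dec l F.≟ l₀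

refines? : ∀ X Y → Dec (∀ k l → Inverts X k l → Drops Y k l)
refines? X Y = all-kinds λ k l → inverts? X k l →-dec drops? Y k l

refines-but? : ∀ X Y k₀ l₀ → Dec (∀ k l → Inverts X k l → Drops Y k l ⊎ (k ≡ k₀ × l ≡ l₀))
refines-but? X Y k₀ l₀ = all-kinds λ k l → inverts? X k l →-dec (drops? Y k l ⊎-dec is? k₀ l₀ k l)

binary? : ∀ X → Dec (∀ k l → Inverts X k l → lookup X k ≡ 1 × lookup X l ≡ 0)
binary? X = all-kinds λ k l → inverts? X k l →-dec (lookup X k ℕ.≟ 1 ×-dec lookup X l ℕ.≟ 0)

abstract

  -- In the checks of this block that allow exceptional pairs, heights alone do not settle those
  -- pairs; they are handled in `Forcing` from the actual positions.
  J-drops : ∀ k l → Inverts J k l → Drops J∗ k l ⊎ (k ≡ at-a × l ≡ at-b)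
  J-drops = from-yes (refines-but? J J∗ at-a at-b)

  J∗-drops : ∀ k l → Inverts J∗ k l →
             (k ≡ at-a × l ≡ lo₂) ⊎ (k ≡ hi₂ × l ≡ lo₂) ⊎ (k ≡ hi₂ × l ≡ at-b)
  J∗-drops = from-yes (all-kinds λ k l → inverts? J∗ k l →-dec
               (is? at-a lo₂ k l ⊎-dec is? hi₂ lo₂ k l ⊎-dec is? hi₂ at-b k l))

  -- The three exceptional pairs follow by transitivity from the inversions of `(P , a)` and
  -- `(b , Q)` in `F` and of `(a , b)` in `J`.
  G-drops : ∀ k l → Inverts G k l → (Drops F k l ⊎ Drops J k l) ⊎
            (k ≡ at-P × l ≡ at-b) ⊎ (k ≡ at-P × l ≡ at-Q) ⊎ (k ≡ at-a × l ≡ at-Q)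
  G-drops = from-yes (all-kinds λ k l → inverts? G k l →-dec
              ((drops? F k l ⊎-dec drops? J k l) ⊎-dec
               is? at-P at-b k l ⊎-dec is? at-P at-Q k l ⊎-dec is? at-a at-Q k l))

  M↑∧F-drops : ∀ k l → Inverts M↑ k l × Inverts F k l → Drops H↑ k l ⊎ (k ≡ at-P × l ≡ lo₃)
  M↑∧F-drops = from-yes (all-kinds λ k l → (inverts? M↑ k l ×-dec inverts? F k l) →-dec
                 (drops? H↑ k l ⊎-dec is? at-P lo₃ k l))

  M↓∧F-drops : ∀ k l → Inverts M↓ k l × Inverts F k l → Drops H↓ k l ⊎ (k ≡ hi₁ × l ≡ at-Q)
  M↓∧F-drops = from-yes (all-kinds λ k l → (inverts? M↓ k l ×-dec inverts? F k l) →-dec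
                 (drops? H↓ k l ⊎-dec is? hi₁ at-Q k l))

  M↑-drops : ∀ k l → Inverts M↑ k l → lookup M↑ k ≡ 1 × lookup M↑ l ≡ 0
  M↑-drops = from-yes (binary? M↑)

  M↓-drops : ∀ k l → Inverts M↓ k l → lookup M↓ k ≡ 1 × lookup M↓ l ≡ 0
  M↓-drops = from-yes (binary? M↓)

  H↑-drops : ∀ k l → Inverts H↑ k l → Drops M↑ k l ⊎ (k ≡ hi₁ × l ≡ at-P)
  H↑-drops = from-yes (refines-but? H↑ M↑ hi₁ at-P)

  H↓-drops : ∀ k l → Inverts H↓ k l → Drops M↓ k l ⊎ (k ≡ at-Q × l ≡ lo₃)
  H↓-drops = from-yes (refines-but? H↓ M↓ at-Q lo₃)

  J∗-refines-J : ∀ k l → Inverts J∗ k l → Drops J k l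
  J∗-refines-J = from-yes (refines? J∗ J)

  J∗-refines-F : ∀ k l → Inverts J∗ k l → Drops F k l
  J∗-refines-F = from-yes (refines? J∗ F)

  F-refines-G : ∀ k l → Inverts F k l → Drops G k l
  F-refines-G = from-yes (refines? F G)

  J-refines-G : ∀ k l → Inverts J k l → Drops G k l
  J-refines-G = from-yes (refines? J G)

  M↑-refines-G : ∀ k l → Inverts M↑ k l → Drops G k l
  M↑-refines-G = from-yes (refines? M↑ G)

  H↑-refines-F : ∀ k l → Inverts H↑ k l → Drops F k l
  H↑-refines-F = from-yes (refines? H↑ F)

  M↓-refines-G : ∀ k l → Inverts M↓ k l → Drops G k l
  M↓-refines-G = from-yes (refines? M↓ G)

  H↓-refines-F : ∀ k l → Inverts H↓ k l → Drops F k l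
  H↓-refines-F = from-yes (refines? H↓ F)

  zone≤4 : ∀ k → lookup zones k ≤ 4
  zone≤4 = from-yes (F.all? λ k → lookup zones k ℕ.≤? 4)

-- J and J∗ are the join-irreducible element of the arc (a, b) and its lower cover:
-- J = J ∧ u′ and J∗ = J ∧ u, so J ∼ J∗.  Next F = F ∨ J∗ and G = F ∨ J, so F ∼ G;
-- F is chosen such that inverting (a, b) in it forces the inversion of (P, Q).
-- Then M, the join-irreducible element of the arc (P, Q), satisfies M = M ∧ G, so
-- it is equivalent to H = M ∧ F, which does not invert (P, Q).  Finally u = x ∨ M
-- and x = x ∨ H.  M and H depend on whether (P, Q) passes above (↑) or below (↓)
-- a and b.
module Forcing
  (C : LatticeCongruence (suc n))
  {u u′ x : S (suc n)} {a b P Q : Fin (suc n)}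
  (up : Cover u u′ a b) (down : Cover x u P Q)
  (u∼u′ : LatticeCongruence._∼_ C u u′)
  (P≤a : P F.≤ a) (b≤Q : b F.≤ Q)
  -- Every point strictly between `a` and `b` lies on the same side of both arcs, so the rising arc
  -- is a subarc of the falling one.
  (between : ∀ c → a < c → c < b →
             (u ⟨$⟩ʳ c < u ⟨$⟩ʳ a × u ⟨$⟩ʳ c < u ⟨$⟩ʳ P) ⊎
             (u ⟨$⟩ʳ b < u ⟨$⟩ʳ c × u ⟨$⟩ʳ P < u ⟨$⟩ʳ c))
  where

  open LatticeCongruence C

  private
    module up = Cover up
    module down = Cover down
    module ∼ = IsEquivalence (LatticeCongruence.isEquivalence C)

  Low High : Fin (suc n) → Set
  Low c  = c < Q × (c < P ⊎ u ⟨$⟩ʳ c < u ⟨$⟩ʳ P)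
  High c = P < c × (Q < c ⊎ u ⟨$⟩ʳ P < u ⟨$⟩ʳ c)

  Zone : ℕ → Fin (suc n) → Set
  Zone 0 c = c < a
  Zone 1 c = c ≡ a
  Zone 2 c = a < c × c < b
  Zone 3 c = c ≡ b
  -- Among the values of `zones` only 4 reaches this clause.
  Zone _ c = b < c

  Detail : Kind → Fin (suc n) → Set
  Detail lo₁  c = Low c
  Detail hi₁  c = High c
  Detail at-P c = c ≡ P
  Detail at-a c = ⊤
  Detail lo₂  c = Low c × u ⟨$⟩ʳ c < u ⟨$⟩ʳ a
  Detail hi₂  c = High c × u ⟨$⟩ʳ b < u ⟨$⟩ʳ c
  Detail at-b c = ⊤
  Detail at-Q c = c ≡ Q
  Detail lo₃  c = Low c
  Detail hi₃  c = High c

  Spec : Kind → Fin (suc n) → Set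
  Spec k c = Zone (lookup zones k) c × Detail k c

  side : ∀ c → c ≢ P → c ≢ Q → Low c ⊎ High c
  side c c≢P c≢Q with F.<-cmp c P | F.<-cmp c Q | F.<-cmp (u ⟨$⟩ʳ c) (u ⟨$⟩ʳ P)
  ... | tri≈ _ p _ | _          | _          = contradiction p c≢P
  ... | _          | tri≈ _ p _ | _          = contradiction p c≢Q
  ... | tri< p _ _ | _          | _          = inj₁ (F.<-trans p down.P<Q , inj₁ p)
  ... | tri> _ _ p | tri> _ _ q | _          = inj₂ (p , inj₁ q)
  ... | tri> _ _ p | tri< q _ _ | tri< r _ _ = inj₁ (q , inj₂ r)
  ... | tri> _ _ p | tri< q _ _ | tri≈ _ r _ = contradiction (perm-injective u r) c≢P
  ... | tri> _ _ p | tri< q _ _ | tri> _ _ r = inj₂ (p , inj₂ r)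

  classify : ∀ c → ∃[ k ] Spec k c
  classify c with F.<-cmp c a | F.<-cmp c b
  ... | tri≈ _ c≡a _ | _            = at-a , c≡a , tt
  ... | tri< c<a _ _ | tri≈ _ c≡b _ = contradiction c<a (F.<-asym (subst (a <_) (sym c≡b) up.P<Q))
  ... | tri> _ _ _   | tri≈ _ c≡b _ = at-b , c≡b , tt
  ... | tri< c<a _ _ | tri> _ _ b<c = contradiction c<a (F.<-asym (F.<-trans up.P<Q b<c))
  ... | tri> _ _ a<c | tri< c<b _ _ = case between c a<c c<b of λ
    { (inj₁ (p , q)) → lo₂ , (a<c , c<b) , (ℕ.<-≤-trans c<b b≤Q , inj₂ q) , p
    ; (inj₂ (p , q)) → hi₂ , (a<c , c<b) , (ℕ.≤-<-trans P≤a a<c , inj₂ q) , p }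
  ... | tri< c<a _ _ | tri< c<b _ _ with c F.≟ P
  ...   | yes c≡P = at-P , c<a , c≡P
  ...   | no c≢P  = case side c c≢P (F.<⇒≢ (ℕ.<-≤-trans c<b b≤Q)) of λ
    { (inj₁ lo) → lo₁ , c<a , lo
    ; (inj₂ hi) → hi₁ , c<a , hi }
  classify c | tri> _ _ a<c | tri> _ _ b<c with c F.≟ Q
  ...   | yes c≡Q = at-Q , b<c , c≡Q
  ...   | no c≢Q  = case side c (λ c≡P → F.<⇒≢ (ℕ.≤-<-trans P≤a a<c) (sym c≡P)) c≢Q of λ
    { (inj₁ lo) → lo₃ , b<c , lo
    ; (inj₂ hi) → hi₃ , b<c , hi }

  kind : Fin (suc n) → Kind
  kind c = proj₁ (classify c)

  spec : ∀ c {k} → kind c ≡ k → Spec k c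
  spec c refl = proj₂ (classify c)

  kind-a : kind a ≡ at-a
  kind-a with F.<-cmp a a | F.<-cmp a b
  ... | tri< _ a≢a _ | _ = contradiction refl a≢a
  ... | tri≈ _ _ _   | _ = refl
  ... | tri> _ a≢a _ | _ = contradiction refl a≢a

  kind-b : kind b ≡ at-b
  kind-b with F.<-cmp b a | F.<-cmp b b
  ... | tri≈ _ b≡a _ | _            = contradiction up.P<Q (F.<-irrefl (sym b≡a))
  ... | tri< b<a _ _ | _            = contradiction b<a (F.<-asym up.P<Q)
  ... | tri> _ _ _   | tri< _ b≢b _ = contradiction refl b≢b
  ... | tri> _ _ _   | tri≈ _ _ _   = refl
  ... | tri> _ _ _   | tri> _ b≢b _ = contradiction refl b≢b

  kind-P : kind P ≡ at-P ⊎ (P ≡ a × kind P ≡ at-a)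
  kind-P with P F.≟ a
  ... | yes refl = inj₂ (refl , kind-a)
  ... | no P≢a with F.<-cmp P a | F.<-cmp P b
  ...   | tri≈ _ P≡a _ | _            = contradiction P≡a P≢a
  ...   | tri> _ _ a<P | _            = contradiction a<P (ℕ.≤⇒≯ P≤a)
  ...   | tri< P<a _ _ | tri≈ _ P≡b _ = contradiction (F.<-trans P<a up.P<Q) (F.<-irrefl P≡b)
  ...   | tri< P<a _ _ | tri> _ _ b<P = contradiction (F.<-trans P<a up.P<Q) (F.<-asym b<P)
  ...   | tri< P<a _ _ | tri< _ _ _ with P F.≟ P
  ...     | yes _  = inj₁ refl
  ...     | no P≢P = contradiction refl P≢P

  kind-Q : kind Q ≡ at-Q ⊎ (Q ≡ b × kind Q ≡ at-b)
  kind-Q with Q F.≟ b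
  ... | yes refl = inj₂ (refl , kind-b)
  ... | no Q≢b with F.<-cmp Q a | F.<-cmp Q b
  ...   | _            | tri≈ _ Q≡b _ = contradiction Q≡b Q≢b
  ...   | _            | tri< Q<b _ _ = contradiction Q<b (ℕ.≤⇒≯ b≤Q)
  ...   | tri≈ _ Q≡a _ | tri> _ _ b<Q = contradiction (F.<-trans up.P<Q b<Q) (F.<-irrefl (sym Q≡a))
  ...   | tri< Q<a _ _ | tri> _ _ b<Q = contradiction (F.<-trans up.P<Q b<Q) (F.<-asym Q<a)
  ...   | tri> _ _ _   | tri> _ _ _ with Q F.≟ Q
  ...     | yes _  = inj₁ refl
  ...     | no Q≢Q = contradiction refl Q≢Q

  ends : (kind P ≡ at-P ⊎ (P ≡ a × kind P ≡ at-a)) × (kind Q ≡ at-Q ⊎ (Q ≡ b × kind Q ≡ at-b))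
  ends = kind-P , kind-Q

  -- The bound on `s` is there because `Zone` does not distinguish the indices from 4 on.
  zone-mono : ∀ {c d} s t → Zone s c → Zone t d → c < d → s ≤ 4 → s ≤ t
  zone-mono 0 _ _ _ _ _ = z≤n
  zone-mono 1 0 refl q r _ = contradiction q (F.<-asym r)
  zone-mono 1 (suc t) _ _ _ _ = s≤s z≤n
  zone-mono 2 0 (p , _) q r _ = contradiction (F.<-trans p r) (F.<-asym q)
  zone-mono 2 1 (p , _) refl r _ = contradiction p (F.<-asym r)
  zone-mono 2 (suc (suc t)) _ _ _ _ = s≤s (s≤s z≤n)
  zone-mono 3 0 refl q r _ = contradiction (F.<-trans up.P<Q r) (F.<-asym q)
  zone-mono 3 1 refl refl r _ = contradiction up.P<Q (F.<-asym r)
  zone-mono 3 2 refl (_ , q) r _ = contradiction q (F.<-asym r)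
  zone-mono 3 (suc (suc (suc t))) _ _ _ _ = s≤s (s≤s (s≤s z≤n))
  zone-mono 4 0 p q r _ = contradiction (F.<-trans up.P<Q (F.<-trans p r)) (F.<-asym q)
  zone-mono 4 1 p refl r _ = contradiction (F.<-trans p r) (F.<-asym up.P<Q)
  zone-mono 4 2 p (_ , q) r _ = contradiction (F.<-trans p r) (F.<-asym q)
  zone-mono 4 3 p refl r _ = contradiction p (F.<-asym r)
  zone-mono 4 (suc (suc (suc (suc t)))) _ _ _ _ = s≤s (s≤s (s≤s (s≤s z≤n)))
  zone-mono (suc (suc (suc (suc (suc s))))) _ _ _ _ (s≤s (s≤s (s≤s (s≤s ()))))

  perm : Key → S (suc n)
  perm X = std λ c → lookup X (kind c)

  Inverted : S (suc n) → Fin (suc n) → Fin (suc n) → Set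
  Inverted z c d = z ⟨$⟩ʳ d < z ⟨$⟩ʳ c

  perm-inverted : ∀ X {c d} → c < d → Inverted (perm X) c d → Inverts X (kind c) (kind d)
  perm-inverted X {c} {d} c<d p =
    zone-mono _ _ (proj₁ (proj₂ (classify c))) (proj₁ (proj₂ (classify d))) c<d (zone≤4 (kind c)) ,
    std-inverted _ c<d p

  perm-inverts : ∀ X {c d} → Drops X (kind c) (kind d) → Inverted (perm X) c d
  perm-inverts X {c} {d} = std-inverts (λ c → lookup X (kind c)) {c} {d}

  perm-inverts′ : ∀ X {c d k l} → kind c ≡ k → kind d ≡ l → Drops X k l → Inverted (perm X) c d
  perm-inverts′ X {c} {d} refl refl = perm-inverts X {c} {d}

  perm-keeps : ∀ X {c d k l} → c < d → kind c ≡ k → kind d ≡ l → ¬ Drops X k l → ¬ Inverted (perm X) c d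
  perm-keeps X c<d refl refl ¬drops p = ¬drops (proj₂ (perm-inverted X c<d p))

  refines⇒⊑ : ∀ X Y → (∀ k l → Inverts X k l → Drops Y k l) → perm X ⊑ perm Y
  refines⇒⊑ X Y r .inverted {c} {d} p q = perm-inverts Y {c} {d} (r (kind c) (kind d) (perm-inverted X p q))

  -- All inversions of `J∗` lie within the interval from `a` to `b`, where low points are below
  -- `u a` and high points above `u b`.
  J∗⊑u : perm J∗ ⊑ u
  J∗⊑u .inverted {c} {d} p q with J∗-drops (kind c) (kind d) (perm-inverted J∗ p q)
  ... | inj₁ (kc , kd) = subst (λ c → u ⟨$⟩ʳ d < u ⟨$⟩ʳ c) (sym (proj₁ (spec c kc))) (proj₂ (proj₂ (spec d kd)))
  ... | inj₂ (inj₁ (kc , kd)) =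
    F.<-trans (proj₂ (proj₂ (spec d kd))) (F.<-trans up.before (proj₂ (proj₂ (spec c kc))))
  ... | inj₂ (inj₂ (kc , kd)) = subst (λ d → u ⟨$⟩ʳ d < u ⟨$⟩ʳ c) (sym (proj₁ (spec d kd))) (proj₂ (proj₂ (spec c kc)))

  J⊑u′ : perm J ⊑ u′
  J⊑u′ .inverted {c} {d} p q with J-drops (kind c) (kind d) (perm-inverted J p q)
  ... | inj₁ r = inverted up.below p (inverted J∗⊑u p (perm-inverts J∗ {c} {d} r))
  ... | inj₂ (kc , kd) = subst₂ (Inverted u′) (sym (proj₁ (spec c kc))) (sym (proj₁ (spec d kd))) up.after

  J∼J∗ : perm J ∼ perm J∗
  J∼J∗ = ∧-cong {u′} {u} {perm J} {perm J} {perm J} {perm J∗} (∼.sym u∼u′) ∼.refl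
    (isMeet u′ (perm J) (perm J) J⊑u′ ⊑-refl λ _ _ q → q)
    (isMeet u (perm J) (perm J∗) J∗⊑u (refines⇒⊑ J∗ J J∗-refines-J) greatest)
    where
    greatest : ∀ z → z ⊑ u → z ⊑ perm J → z ⊑ perm J∗
    greatest z z⊑u z⊑J .inverted {c} {d} p q with J-drops (kind c) (kind d) (perm-inverted J p (inverted z⊑J p q))
    ... | inj₁ r = perm-inverts J∗ {c} {d} r
    ... | inj₂ (kc , kd) = contradiction up.before (F.<-asym
            (subst₂ (Inverted u) (proj₁ (spec c kc)) (proj₁ (spec d kd)) (inverted z⊑u p q)))

  F∼G : perm F ∼ perm G
  F∼G = ∨-cong {perm F} {perm F} {perm J∗} {perm J} {perm F} {perm G} ∼.refl (∼.sym J∼J∗)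
    (isJoin (perm F) (perm J∗) (perm F) ⊑-refl (refines⇒⊑ J∗ F J∗-refines-F) λ _ p _ → p)
    (isJoin (perm F) (perm J) (perm G) (refines⇒⊑ F G F-refines-G)
                                       (refines⇒⊑ J G J-refines-G) smallest)
    where
    smallest : ∀ z → perm F ⊑ z → perm J ⊑ z → perm G ⊑ z
    smallest z F⊑z J⊑z .inverted {c} {d} p q = go (G-drops (kind c) (kind d) (perm-inverted G p q))
      where
      a<b : Inverted z a b
      a<b = inverted J⊑z up.P<Q (perm-inverts′ J kind-a kind-b (s≤s (s≤s z≤n)))
      P<a : kind c ≡ at-P → Inverted z c a
      P<a kc = inverted F⊑z (proj₁ (spec c kc)) (perm-inverts′ F kc kind-a (s≤s (s≤s z≤n)))
      b<Q : kind d ≡ at-Q → Inverted z b d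
      b<Q kd = inverted F⊑z (proj₁ (spec d kd)) (perm-inverts′ F kind-b kd (s≤s (s≤s (s≤s (s≤s z≤n)))))
      go : _ → Inverted z c d
      go (inj₁ (inj₁ r)) = inverted F⊑z p (perm-inverts F {c} {d} r)
      go (inj₁ (inj₂ r)) = inverted J⊑z p (perm-inverts J {c} {d} r)
      go (inj₂ (inj₁ (kc , kd))) =
        subst (Inverted z c) (sym (proj₁ (spec d kd))) (F.<-trans a<b (P<a kc))
      go (inj₂ (inj₂ (inj₁ (kc , kd)))) = F.<-trans (b<Q kd) (F.<-trans a<b (P<a kc))
      go (inj₂ (inj₂ (inj₂ (kc , kd)))) =
        subst (λ c → Inverted z c d) (sym (proj₁ (spec c kc))) (F.<-trans (b<Q kd) a<b)

  conclude : (m h : Key) → perm m ⊑ u → Inverted (perm m) P Q → ¬ Inverted (perm h) P Q →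
             perm m ⊑ perm G → perm h ⊑ perm m → perm h ⊑ perm F →
             (∀ z → z ⊑ perm m → z ⊑ perm F → z ⊑ perm h) → x ∼ u
  conclude m h m⊑u mPQ ¬hPQ m⊑G h⊑m h⊑F greatest = ∨-cong {x} {x} {perm h} {perm m} {x} {u} ∼.refl h∼m
    (isJoin x (perm h) x ⊑-refl h⊑x λ _ p _ → p)
    (isJoin x (perm m) u down.below m⊑u smallest)
    where
    h∼m : perm h ∼ perm m
    h∼m = ∧-cong {perm m} {perm m} {perm F} {perm G} {perm h} {perm m} ∼.refl F∼G
      (isMeet (perm m) (perm F) (perm h) h⊑m h⊑F greatest)
      (isMeet (perm m) (perm G) (perm m) ⊑-refl m⊑G λ _ p _ → p)
    -- The pair `(P , Q)` is the only inversion of `u` missing from `x`, and `h` avoids it.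
    h⊑x : perm h ⊑ x
    h⊑x .inverted p q with down.only p (inverted m⊑u p (inverted h⊑m p q))
    ... | inj₁ r = r
    ... | inj₂ (refl , refl) = contradiction q ¬hPQ
    smallest : ∀ z → x ⊑ z → perm m ⊑ z → u ⊑ z
    smallest z x⊑z m⊑z .inverted p q with down.only p q
    ... | inj₁ r = inverted x⊑z p r
    ... | inj₂ (refl , refl) = inverted m⊑z p mPQ

  -- Weakened forms of `High` and `Low` that admit `P` and `Q` themselves.
  AtLeast AtMost : Fin (suc n) → Set
  AtLeast c = P F.≤ c × (Q < c ⊎ u ⟨$⟩ʳ P F.≤ u ⟨$⟩ʳ c)
  AtMost c  = c F.≤ Q × (c < P ⊎ u ⟨$⟩ʳ c < u ⟨$⟩ʳ P)

  high : ∀ {c} → High c → AtLeast c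
  high (p , inj₁ q) = ℕ.<⇒≤ p , inj₁ q
  high (p , inj₂ q) = ℕ.<⇒≤ p , inj₂ (ℕ.<⇒≤ q)

  low : ∀ {c} → Low c → AtMost c
  low (p , q) = ℕ.<⇒≤ p , q

  at-most-Q : AtMost Q
  at-most-Q = ℕ.≤-refl , inj₂ down.after

  at-least-P : AtLeast P
  at-least-P = ℕ.≤-refl , inj₂ ℕ.≤-refl

  -- Nothing right of a position beyond `Q` is `AtMost`, and nothing left of a position before `P`
  -- is `AtLeast`; in the remaining case the value `u P` separates the two.
  split⇒inverted : ∀ {c d} → c < d → AtLeast c → AtMost d → Inverted u c d
  split⇒inverted c<d (_ , inj₁ Q<c) (d≤Q , _)      = contradiction (ℕ.<-≤-trans c<d d≤Q) (F.<-asym Q<c)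
  split⇒inverted c<d (P≤c , _)      (_ , inj₁ d<P) = contradiction (ℕ.≤-<-trans P≤c c<d) (F.<-asym d<P)
  split⇒inverted c<d (_ , inj₂ p)   (_ , inj₂ q)   = ℕ.<-≤-trans q p

  -- The hypotheses exclude `P = a` but allow `Q = b`, which is consistent with `at-b` having height
  -- 0 in `M↑`.
  forcing↑ : u ⟨$⟩ʳ a < u ⟨$⟩ʳ P → u ⟨$⟩ʳ b < u ⟨$⟩ʳ P → x ∼ u
  forcing↑ ua<uP ub<uP = conclude M↑ H↑ m⊑u mPQ ¬hPQ
    (refines⇒⊑ M↑ G M↑-refines-G) h⊑m (refines⇒⊑ H↑ F H↑-refines-F) greatest
    where
    m-high : ∀ {c} k → Spec k c → lookup M↑ k ≡ 1 → AtLeast c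
    m-high hi₁  (_ , p)     _ = high p
    m-high at-P (_ , refl)  _ = at-least-P
    m-high hi₂  (_ , p , _) _ = high p
    m-high hi₃  (_ , p)     _ = high p
    m-high lo₁ _ ()
    m-high at-a _ ()
    m-high lo₂ _ ()
    m-high at-b _ ()
    m-high at-Q _ ()
    m-high lo₃ _ ()
    m-low : ∀ {c} k → Spec k c → lookup M↑ k ≡ 0 → AtMost c
    m-low lo₁  (_ , p)     _ = low p
    m-low at-a (refl , _)  _ = ℕ.≤-trans (ℕ.<⇒≤ up.P<Q) b≤Q , inj₂ ua<uP
    m-low lo₂  (_ , p , _) _ = low p
    m-low at-b (refl , _)  _ = b≤Q , inj₂ ub<uP
    m-low at-Q (_ , refl)  _ = at-most-Q
    m-low lo₃  (_ , p)     _ = low p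
    m-low hi₁ _ ()
    m-low at-P _ ()
    m-low hi₂ _ ()
    m-low hi₃ _ ()
    m⊑u : perm M↑ ⊑ u
    m⊑u .inverted {c} {d} p q = let (kc , kd) = M↑-drops (kind c) (kind d) (perm-inverted M↑ p q) in
      split⇒inverted p (m-high (kind c) (spec c refl) kc) (m-low (kind d) (spec d refl) kd)
    mPQ : Inverted (perm M↑) P Q
    mPQ = case ends of λ
      { (inj₂ (refl , _) , _)               → contradiction ua<uP (F.<-irrefl refl)
      ; (inj₁ kP         , inj₁ kQ)         → perm-inverts′ M↑ kP kQ (s≤s z≤n)
      ; (inj₁ kP         , inj₂ (_ , kQ))   → perm-inverts′ M↑ kP kQ (s≤s z≤n) }
    ¬hPQ : ¬ Inverted (perm H↑) P Q
    ¬hPQ = case ends of λ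
      { (inj₁ kP       , inj₁ kQ)       → perm-keeps H↑ down.P<Q kP kQ (ℕ.≤⇒≯ (s≤s z≤n))
      ; (inj₁ kP       , inj₂ (_ , kQ)) → perm-keeps H↑ down.P<Q kP kQ (ℕ.≤⇒≯ (s≤s z≤n))
      ; (inj₂ (_ , kP) , inj₁ kQ)       → perm-keeps H↑ down.P<Q kP kQ λ ()
      ; (inj₂ (_ , kP) , inj₂ (_ , kQ)) → perm-keeps H↑ down.P<Q kP kQ λ () }
    h⊑m : perm H↑ ⊑ perm M↑
    h⊑m .inverted {c} {d} p q with H↑-drops (kind c) (kind d) (perm-inverted H↑ p q)
    ... | inj₁ r = perm-inverts M↑ {c} {d} r
    ... | inj₂ (kc , kd) = contradiction p (F.<-asym
            (subst (_< c) (sym (proj₂ (spec d kd))) (proj₁ (proj₂ (spec c kc)))))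
    greatest : ∀ z → z ⊑ perm M↑ → z ⊑ perm F → z ⊑ perm H↑
    greatest z z⊑m z⊑F .inverted {c} {d} p q
      with M↑∧F-drops (kind c) (kind d) (perm-inverted M↑ p (inverted z⊑m p q) , perm-inverted F p (inverted z⊑F p q))
    ... | inj₁ r = perm-inverts H↑ {c} {d} r
    -- Both `M↑` and `F` invert this pair, but no common lower bound does: `F` keeps the order of
    -- `c` and `b`, and `M↑` that of `b` and `d`.
    ... | inj₂ (kc , kd) = contradiction q (F.<-asym (F.<-trans
            (not-inverted z c<b λ r → perm-keeps F c<b kc kind-b (ℕ.≤⇒≯ (s≤s (s≤s z≤n))) (inverted z⊑F c<b r))
            (not-inverted z b<d λ r → perm-keeps M↑ b<d kind-b kd (λ ()) (inverted z⊑m b<d r))))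
      where
      c<b : c < b
      c<b = F.<-trans (proj₁ (spec c kc)) up.P<Q
      b<d : b < d
      b<d = proj₁ (spec d kd)

  -- Here `P = a` is allowed and `Q = b` is excluded, since `u Q < u P < u b`.
  forcing↓ : u ⟨$⟩ʳ P F.≤ u ⟨$⟩ʳ a → u ⟨$⟩ʳ P < u ⟨$⟩ʳ b → x ∼ u
  forcing↓ uP≤ua uP<ub = conclude M↓ H↓ m⊑u mPQ ¬hPQ
    (refines⇒⊑ M↓ G M↓-refines-G) h⊑m (refines⇒⊑ H↓ F H↓-refines-F) greatest
    where
    m-high : ∀ {c} k → Spec k c → lookup M↓ k ≡ 1 → AtLeast c
    m-high hi₁  (_ , p)     _ = high p
    m-high at-P (_ , refl)  _ = at-least-P
    m-high at-a (refl , _)  _ = P≤a , inj₂ uP≤ua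
    m-high hi₂  (_ , p , _) _ = high p
    m-high at-b (refl , _)  _ = ℕ.≤-trans P≤a (ℕ.<⇒≤ up.P<Q) , inj₂ (ℕ.<⇒≤ uP<ub)
    m-high hi₃  (_ , p)     _ = high p
    m-high lo₁ _ ()
    m-high lo₂ _ ()
    m-high at-Q _ ()
    m-high lo₃ _ ()
    m-low : ∀ {c} k → Spec k c → lookup M↓ k ≡ 0 → AtMost c
    m-low lo₁  (_ , p)     _ = low p
    m-low lo₂  (_ , p , _) _ = low p
    m-low at-Q (_ , refl)  _ = at-most-Q
    m-low lo₃  (_ , p)     _ = low p
    m-low hi₁ _ ()
    m-low at-P _ ()
    m-low at-a _ ()
    m-low hi₂ _ ()
    m-low at-b _ ()
    m-low hi₃ _ ()
    m⊑u : perm M↓ ⊑ u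
    m⊑u .inverted {c} {d} p q = let (kc , kd) = M↓-drops (kind c) (kind d) (perm-inverted M↓ p q) in
      split⇒inverted p (m-high (kind c) (spec c refl) kc) (m-low (kind d) (spec d refl) kd)
    mPQ : Inverted (perm M↓) P Q
    mPQ = case ends of λ
      { (_              , inj₂ (refl , _)) → contradiction uP<ub (F.<-asym down.after)
      ; (inj₁ kP        , inj₁ kQ)         → perm-inverts′ M↓ kP kQ (s≤s z≤n)
      ; (inj₂ (_ , kP)  , inj₁ kQ)         → perm-inverts′ M↓ kP kQ (s≤s z≤n) }
    ¬hPQ : ¬ Inverted (perm H↓) P Q
    ¬hPQ = case ends of λ
      { (inj₁ kP       , inj₁ kQ)       → perm-keeps H↓ down.P<Q kP kQ (ℕ.≤⇒≯ (s≤s z≤n))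
      ; (inj₁ kP       , inj₂ (_ , kQ)) → perm-keeps H↓ down.P<Q kP kQ (ℕ.≤⇒≯ (s≤s z≤n))
      ; (inj₂ (_ , kP) , inj₁ kQ)       → perm-keeps H↓ down.P<Q kP kQ (ℕ.≤⇒≯ (s≤s z≤n))
      ; (inj₂ (_ , kP) , inj₂ (_ , kQ)) → perm-keeps H↓ down.P<Q kP kQ (ℕ.≤⇒≯ (s≤s z≤n)) }
    h⊑m : perm H↓ ⊑ perm M↓
    h⊑m .inverted {c} {d} p q with H↓-drops (kind c) (kind d) (perm-inverted H↓ p q)
    ... | inj₁ r = perm-inverts M↓ {c} {d} r
    ... | inj₂ (kc , kd) = contradiction p (F.<-asym
            (subst (d <_) (sym (proj₂ (spec c kc))) (proj₁ (proj₂ (spec d kd)))))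
    greatest : ∀ z → z ⊑ perm M↓ → z ⊑ perm F → z ⊑ perm H↓
    greatest z z⊑m z⊑F .inverted {c} {d} p q
      with M↓∧F-drops (kind c) (kind d) (perm-inverted M↓ p (inverted z⊑m p q) , perm-inverted F p (inverted z⊑F p q))
    ... | inj₁ r = perm-inverts H↓ {c} {d} r
    -- Now `a` is the intermediate position: `M↓` keeps the order of `c` and `a`, and `F` that of
    -- `a` and `d`.
    ... | inj₂ (kc , kd) = contradiction q (F.<-asym (F.<-trans
            (not-inverted z c<a λ r → perm-keeps M↓ c<a kc kind-a (ℕ.≤⇒≯ (s≤s z≤n)) (inverted z⊑m c<a r))
            (not-inverted z a<d λ r → perm-keeps F a<d kind-a kd (ℕ.≤⇒≯ (s≤s z≤n)) (inverted z⊑F a<d r))))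
      where
      c<a : c < a
      c<a = proj₁ (spec c kc)
      a<d : a < d
      a<d = F.<-trans up.P<Q (proj₁ (spec d kd))

-- The upper bound

first : {R : Fin n → Set} → Decidable R → ∃ R → ∃[ h ] R h × (∀ k → k < h → ¬ R k)
first {suc n} {R} R? (y , r) with R? zero
... | yes r₀ = zero , r₀ , λ _ ()
... | no ¬r₀ with y
...   | zero   = contradiction r ¬r₀
...   | suc y′ with first (R? ∘ suc) (y′ , r)
...     | h , r′ , before = suc h , r′ , λ { zero _ → ¬r₀ ; (suc k) p → before k (s≤s⁻¹ p) }

last : {R : Fin n → Set} → Decidable R → ∃ R → ∃[ h ] R h × (∀ k → h < k → ¬ R k)
last {suc n} {R} R? (y , r) with F.any? (R? ∘ suc)
... | yes hit with last (R? ∘ suc) hit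
...   | h , r′ , after = suc h , r′ , λ { (suc k) p → after k (s≤s⁻¹ p) }
last {suc n} {R} R? (zero , r)  | no miss = zero , r , λ { (suc k) _ r′ → miss (k , r′) }
last {suc n} {R} R? (suc y , r) | no miss = contradiction (y , r) miss

-- Each element of `p` uses up the element it is charged to, which is deleted before the recursion;
-- injectivity keeps the other charges valid. The relations are injective separately, so with `q₁`
-- equal to `q₂` an element may be charged twice.
∣∣-charge : (p : Subset k) (q₁ q₂ : Subset m) (R₁ R₂ : Fin k → Fin m → Set) →
            (∀ {i} → i ∈ p → (∃[ j ] j ∈ q₁ × R₁ i j) ⊎ (∃[ j ] j ∈ q₂ × R₂ i j)) →
            (∀ {i i′ j} → R₁ i j → R₁ i′ j → i ≡ i′) → (∀ {i i′ j} → R₂ i j → R₂ i′ j → i ≡ i′) →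
            ∣ p ∣ ≤ ∣ q₁ ∣ + ∣ q₂ ∣
∣∣-charge [] _ _ _ _ _ _ _ = z≤n
∣∣-charge (outside ∷ p) q₁ q₂ R₁ R₂ charge inj-R₁ inj-R₂ =
  ∣∣-charge p q₁ q₂ (R₁ ∘ suc) (R₂ ∘ suc) (charge ∘ there)
    (λ r r′ → F.suc-injective (inj-R₁ r r′)) (λ r r′ → F.suc-injective (inj-R₂ r r′))
∣∣-charge (inside ∷ p) q₁ q₂ R₁ R₂ charge inj-R₁ inj-R₂ with charge here
... | inj₁ (j , j∈ , r₀) = ℕ.≤-trans
  (s≤s (∣∣-charge p (q₁ - j) q₂ (R₁ ∘ suc) (R₂ ∘ suc)
    (λ i∈ → case charge (there i∈) of λ
      { (inj₁ (j′ , j′∈ , r)) → inj₁ (j′ , x∈p∧x≢y⇒x∈p-y j′∈ (λ { refl → case inj-R₁ r₀ r of λ () }) , r)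
      ; (inj₂ c)              → inj₂ c })
    (λ r r′ → F.suc-injective (inj-R₁ r r′)) (λ r r′ → F.suc-injective (inj-R₂ r r′))))
  (ℕ.+-monoˡ-≤ ∣ q₂ ∣ (x∈p⇒∣p-x∣<∣p∣ j∈))
... | inj₂ (j , j∈ , r₀) = ℕ.≤-trans
  (s≤s (∣∣-charge p q₁ (q₂ - j) (R₁ ∘ suc) (R₂ ∘ suc)
    (λ i∈ → case charge (there i∈) of λ
      { (inj₁ c)              → inj₁ c
      ; (inj₂ (j′ , j′∈ , r)) → inj₂ (j′ , x∈p∧x≢y⇒x∈p-y j′∈ (λ { refl → case inj-R₂ r₀ r of λ () }) , r) })
    (λ r r′ → F.suc-injective (inj-R₁ r r′)) (λ r r′ → F.suc-injective (inj-R₂ r r′))))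
  (ℕ.≤-trans (ℕ.≤-reflexive (sym (ℕ.+-suc ∣ q₁ ∣ _))) (ℕ.+-monoʳ-≤ ∣ q₁ ∣ (x∈p⇒∣p-x∣<∣p∣ j∈)))

<⇒suc≤inject₁ : {i i′ : Fin n} → i < i′ → suc i F.≤ inject₁ i′
<⇒suc≤inject₁ {i′ = i′} p = ℕ.≤-trans p (ℕ.≤-reflexive (sym (F.toℕ-inject₁ i′)))

suc≤inject₁⇒inject₁< : (i i′ : Fin n) → suc i F.≤ inject₁ i′ → inject₁ i < inject₁ i′
suc≤inject₁⇒inject₁< i i′ p = ℕ.<-≤-trans (inject₁<suc i) p

-- Charging lifted arcs to falling arcs

module Bound
  (C : LatticeCongruence (suc n)) (essential : Essential C)
  (u w : S (suc n)) (u∼w : LatticeCongruence._∼_ C u w)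
  (u⊑class : ∀ z → LatticeCongruence._∼_ C z w → u ⊑ z)
  where

  open LatticeCongruence C

  private
    module ∼ = IsEquivalence (LatticeCongruence.isEquivalence C)

  pos : Fin (suc n) → Fin (suc n)
  pos y = u ⟨$⟩ˡ y

  u-pos : ∀ {y} → u ⟨$⟩ʳ pos y ≡ y
  u-pos = inverseʳ u

  pos-u : ∀ {c} → pos (u ⟨$⟩ʳ c) ≡ c
  pos-u = inverseˡ u

  u⊑w : u ⊑ w
  u⊑w = u⊑class w ∼.refl

  -- Lifted i says that i ∈ D_R(w u⁻¹).
  Falling Lifted : Fin n → Set
  Falling i = pos (suc i) < pos (inject₁ i)
  Lifted i  = w ⟨$⟩ʳ pos (suc i) < w ⟨$⟩ʳ pos (inject₁ i)

  -- If the arc fell, `u` and hence `w` would invert its two positions, against `Lifted`.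
  lifted⇒rising : ∀ i → Lifted i → pos (inject₁ i) < pos (suc i)
  lifted⇒rising i lifted with F.<-cmp (pos (inject₁ i)) (pos (suc i))
  ... | tri< p _ _ = p
  ... | tri≈ _ p _ = contradiction p (inject₁≢suc u i)
  ... | tri> _ _ p = contradiction lifted (F.<-asym
          (inverted u⊑w p (subst₂ _<_ (sym u-pos) (sym u-pos) (inject₁<suc i))))

  -- Since `w` inverts the one pair that `s i · u` adds to `u`, the permutation `s i · u` lies
  -- between `u` and `w`; meeting both with it gives `u` and `s i · u`.
  lifted⇒contracted : ∀ i → Lifted i → u ∼ s i · u
  lifted⇒contracted i lifted = ∧-cong {u} {w} {s i · u} {s i · u} {u} {s i · u} u∼w ∼.refl
    (isMeet u (s i · u) u ⊑-refl up.below λ _ p _ → p)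
    (isMeet w (s i · u) (s i · u) su⊑w ⊑-refl λ _ _ p → p)
    where
    module up = Cover (s-cover u i (lifted⇒rising i lifted))
    su⊑w : s i · u ⊑ w
    su⊑w .inverted p q with up.only p q
    ... | inj₁ r = inverted u⊑w p r
    ... | inj₂ (refl , refl) = lifted

  falling⇒uncontracted : ∀ j → Falling j → ¬ (s j · u ∼ u)
  falling⇒uncontracted j falling x∼u =
    F.<-asym down.before (inverted (u⊑class (s j · u) (∼.trans x∼u u∼w)) down.P<Q down.after)
    where
    module down = Cover (s-cocover u j falling)

  -- If the two positions were adjacent, their atom would lie below `s i · u` and meet `u` in `e`.
  -- Meeting `s i · u ∼ u` with this atom would then make it equivalent to `e`, against
  -- essentiality.
  lifted⇒gap : ∀ i → Lifted i → Σ[ r ∈ Fin (suc n) ] pos (inject₁ i) < r × r < pos (suc i)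
  lifted⇒gap i lifted = go (pos (suc i)) refl
    where
    rising = lifted⇒rising i lifted
    module up = Cover (s-cover u i rising)
    go : ∀ q → pos (suc i) ≡ q → Σ[ r ∈ Fin (suc n) ] pos (inject₁ i) < r × r < pos (suc i)
    go zero eq = contradiction (subst (pos (inject₁ i) <_) eq rising) λ ()
    go (suc q) eq with pos (inject₁ i) F.≟ inject₁ q
    ... | no p≢q = inject₁ q , ≤∧≢⇒<ᶠ (<suc⇒≤inject₁ q (subst (pos (inject₁ i) <_) eq rising)) p≢q ,
                   subst (inject₁ q <_) (sym eq) (inject₁<suc q)
    ... | yes p≡q = contradiction
        (subst₂ _<_ (atom≈e (suc q)) (atom≈e (inject₁ q)) (atom-descent q)) (F.<-asym (inject₁<suc q))
      where
      su : S (suc n)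
      su = s i · u
      atom⊑su : atom q ⊑ su
      atom⊑su = atom⊑ q (subst₂ (λ c d → su ⟨$⟩ʳ d < su ⟨$⟩ʳ c) p≡q eq up.after)
      e⊑ : ∀ z → e ⊑ z
      e⊑ z .inverted p r = contradiction p (F.<-asym r)
      bottom : ∀ z → z ⊑ u → z ⊑ atom q → z ⊑ e
      bottom z z⊑u z⊑atom .inverted {c} {d} p r
        with Cover.only (s-cover e q (inject₁<suc q)) p (inverted z⊑atom p r)
      ... | inj₁ r′ = r′
      ... | inj₂ (refl , refl) = contradiction
              (subst₂ (λ c d → u ⟨$⟩ʳ d < u ⟨$⟩ʳ c) (sym p≡q) (sym eq) (inverted z⊑u p r)) (F.<-asym up.before)
      atom∼e : atom q ∼ e
      atom∼e = ∧-cong {su} {u} {atom q} {atom q} {atom q} {e} (∼.sym (lifted⇒contracted i lifted)) ∼.refl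
        (isMeet su (atom q) (atom q) atom⊑su ⊑-refl λ _ _ p → p)
        (isMeet u (atom q) e (e⊑ u) (e⊑ (atom q)) bottom)
      atom≈e : ∀ c → atom q ⟨$⟩ʳ c ≡ c
      atom≈e = essential (atom q) atom∼e

  -- j is the first falling arc above i that comes back over i.
  record Above (i j : Fin n) : Set where
    field
      falling : Falling j
      left    : pos (suc j) < pos (suc i)
      right   : pos (inject₁ i) < pos (suc j)
      higher  : suc i F.≤ inject₁ j
      strip   : ∀ y → suc i F.≤ y → y F.≤ inject₁ j → pos (suc i) F.≤ pos y

  -- j is the last falling arc below i that comes back under i.
  record Below (i j : Fin n) : Set where
    field
      falling : Falling j
      left    : pos (inject₁ j) < pos (suc i)
      right   : pos (inject₁ i) < pos (inject₁ j)
      lower   : suc j F.≤ inject₁ i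
      strip   : ∀ y → suc j F.≤ y → y F.≤ inject₁ i → pos y F.≤ pos (inject₁ i)

  -- If `i < i′` share `j`, the value `i′` lies in the strip of `i`, so its position is weakly right
  -- of the upper end of arc `i`. But `right` for `i′` and `left` for `i` put it strictly to the
  -- left.
  above-injective : ∀ {i i′ j} → Above i j → Above i′ j → i ≡ i′
  above-injective {i} {i′} {j} α α′ with F.<-cmp i i′
  ... | tri≈ _ eq _ = eq
  ... | tri< p _ _ = contradiction (ℕ.≤-<-trans (Above.strip α (inject₁ i′) (<⇒suc≤inject₁ p)
                       (ℕ.<⇒≤ (suc≤inject₁⇒inject₁< i′ j (Above.higher α′)))) (Above.right α′))
                       (F.<-asym (Above.left α))
  ... | tri> _ _ p = contradiction (ℕ.≤-<-trans (Above.strip α′ (inject₁ i) (<⇒suc≤inject₁ p)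
                       (ℕ.<⇒≤ (suc≤inject₁⇒inject₁< i j (Above.higher α)))) (Above.right α))
                       (F.<-asym (Above.left α′))

  suc-mono-inject₁ : ∀ {i j : Fin n} → suc j F.≤ inject₁ i → suc j F.≤ suc i
  suc-mono-inject₁ {i} p = ℕ.≤-trans p (ℕ.<⇒≤ (inject₁<suc i))

  -- For `i < i′` the value `i + 1` lies in the strip of `i′`, and the same chain of inequalities
  -- closes into a cycle.
  below-injective : ∀ {i i′ j} → Below i j → Below i′ j → i ≡ i′
  below-injective {i} {i′} {j} β β′ with F.<-cmp i i′
  ... | tri≈ _ eq _ = eq
  ... | tri< p _ _ = contradiction (ℕ.≤-<-trans (Below.strip β′ (suc i) (suc-mono-inject₁ {i} {j} (Below.lower β))
                       (<⇒suc≤inject₁ p)) (Below.right β′)) (F.<-asym (Below.left β))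
  ... | tri> _ _ p = contradiction (ℕ.≤-<-trans (Below.strip β (suc i′) (suc-mono-inject₁ {i′} {j} (Below.lower β′))
                       (<⇒suc≤inject₁ p)) (Below.right β)) (F.<-asym (Below.left β′))

  gap⇒above : ∀ i → Lifted i → ∀ r → r < pos (suc i) → suc i < u ⟨$⟩ʳ r → ∃[ j ] Above i j
  gap⇒above i lifted r r<b high =
    go (first (λ y → suc i F.<? y ×-dec pos y F.<? pos (suc i)) (u ⟨$⟩ʳ r , high , subst (_< pos (suc i)) (sym pos-u) r<b))
    where
    Crossing : Fin (suc n) → Set
    Crossing y = suc i < y × pos y < pos (suc i)
    go : (∃[ h ] Crossing h × (∀ y → y < h → ¬ Crossing y)) → ∃[ j ] Above i j
    -- The first crossing value exceeds `i + 1`, so it is nonzero and is the upper end of an arc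
    -- `j`.
    go (suc j , (i<j , j<b) , before) = j , record
      { falling = falling ; left = j<b ; right = right ; higher = higher ; strip = strip }
      where
      higher : suc i F.≤ inject₁ j
      higher = <suc⇒≤inject₁ j i<j
      strip : ∀ y → suc i F.≤ y → y F.≤ inject₁ j → pos (suc i) F.≤ pos y
      strip y i≤y y≤j with suc i F.≟ y
      ... | yes refl = ℕ.≤-refl
      ... | no i≢y = ℕ.≮⇒≥ λ p → before y (ℕ.≤-<-trans y≤j (inject₁<suc j)) (≤∧≢⇒<ᶠ i≤y i≢y , p)
      falling : Falling j
      falling = ℕ.<-≤-trans j<b (strip (inject₁ j) higher ℕ.≤-refl)
      module _ (P≤a : pos (suc j) F.≤ pos (inject₁ i)) where
        between : ∀ c → pos (inject₁ i) < c → c < pos (suc i) →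
                  (u ⟨$⟩ʳ c < u ⟨$⟩ʳ pos (inject₁ i) × u ⟨$⟩ʳ c < u ⟨$⟩ʳ pos (suc j)) ⊎
                  (u ⟨$⟩ʳ pos (suc i) < u ⟨$⟩ʳ c × u ⟨$⟩ʳ pos (suc j) < u ⟨$⟩ʳ c)
        between c a<c c<b
          rewrite u-pos {inject₁ i} | u-pos {suc i} | u-pos {suc j}
          with F.<-cmp (u ⟨$⟩ʳ c) (inject₁ i)
        ... | tri< p _ _ = inj₁ (p , F.<-trans p (F.<-trans (inject₁<suc i) i<j))
        ... | tri≈ _ p _ = contradiction a<c (F.<-irrefl (trans (cong pos (sym p)) pos-u))
        ... | tri> _ _ p = inj₂ (≤∧≢⇒<ᶠ i≤c i≢c , ℕ.≰⇒> λ c≤j → absurd c≤j)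
          where
          i≤c : suc i F.≤ u ⟨$⟩ʳ c
          i≤c = inject₁<⇒suc≤ i p
          i≢c : suc i ≢ u ⟨$⟩ʳ c
          i≢c eq = F.<-irrefl (trans (sym pos-u) (cong pos (sym eq))) c<b
          -- A value at most `j + 1` would place `c` at `pos (suc j)`, which is not right of `a`, or
          -- by `strip` weakly right of `b`.
          absurd : ¬ (u ⟨$⟩ʳ c F.≤ suc j)
          absurd c≤j with u ⟨$⟩ʳ c F.≟ suc j
          ... | yes eq = ℕ.<⇒≱ a<c (subst (F._≤ pos (inject₁ i)) (trans (cong pos (sym eq)) pos-u) P≤a)
          ... | no c≢j = ℕ.<⇒≱ c<b (subst (pos (suc i) F.≤_) pos-u
                           (strip (u ⟨$⟩ʳ c) i≤c (<suc⇒≤inject₁ j (≤∧≢⇒<ᶠ c≤j c≢j))))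
        forced : s j · u ∼ u
        forced = Forcing.forcing↑ C (s-cover u i (lifted⇒rising i lifted)) (s-cocover u j falling)
          (lifted⇒contracted i lifted) P≤a (strip (inject₁ j) higher ℕ.≤-refl) between
          (subst₂ _<_ (sym u-pos) (sym u-pos) (F.<-trans (inject₁<suc i) i<j))
          (subst₂ _<_ (sym u-pos) (sym u-pos) i<j)
      right : pos (inject₁ i) < pos (suc j)
      right = ℕ.≰⇒> λ P≤a → falling⇒uncontracted j falling (forced P≤a)

  gap⇒below : ∀ i → Lifted i → ∀ r → pos (inject₁ i) < r → u ⟨$⟩ʳ r < inject₁ i → ∃[ j ] Below i j
  gap⇒below i lifted r a<r low =
    go (last (λ y → y F.<? inject₁ i ×-dec pos (inject₁ i) F.<? pos y) (u ⟨$⟩ʳ r , low , subst (pos (inject₁ i) <_) (sym pos-u) a<r))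
    where
    Crossing : Fin (suc n) → Set
    Crossing y = y < inject₁ i × pos (inject₁ i) < pos y
    go : (∃[ h ] Crossing h × (∀ y → h < y → ¬ Crossing y)) → ∃[ j ] Below i j
    go (h , (h<i , a<h) , after) = j , record
      { falling = falling ; left = left ; right = a<j ; lower = lower ; strip = strip }
      where
      -- Here the crossing value is the lower end of the arc; being less than `i`, it is not the
      -- largest value and so does start an arc.
      h<n : toℕ h ℕ.< n
      h<n = ℕ.<-trans (subst (toℕ h ℕ.<_) (F.toℕ-inject₁ i) h<i) (F.toℕ<n i)
      j : Fin n
      j = fromℕ< h<n
      j≡h : inject₁ j ≡ h
      j≡h = F.toℕ-injective (trans (F.toℕ-inject₁ j) (F.toℕ-fromℕ< h<n))
      lower : suc j F.≤ inject₁ i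
      lower = inject₁<⇒suc≤ j (subst (_< inject₁ i) (sym j≡h) h<i)
      a<j : pos (inject₁ i) < pos (inject₁ j)
      a<j = subst (λ y → pos (inject₁ i) < pos y) (sym j≡h) a<h
      strip : ∀ y → suc j F.≤ y → y F.≤ inject₁ i → pos y F.≤ pos (inject₁ i)
      strip y j≤y y≤i with y F.≟ inject₁ i
      ... | yes refl = ℕ.≤-refl
      ... | no y≢i = ℕ.≮⇒≥ λ p → after y (subst (_< y) j≡h (ℕ.<-≤-trans (inject₁<suc j) j≤y)) (≤∧≢⇒<ᶠ y≤i y≢i , p)
      falling : Falling j
      falling = ℕ.≤-<-trans (strip (suc j) ℕ.≤-refl lower) a<j
      j<i : suc j < suc i
      j<i = ℕ.≤-<-trans lower (inject₁<suc i)
      module _ (b≤Q : pos (suc i) F.≤ pos (inject₁ j)) where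
        between : ∀ c → pos (inject₁ i) < c → c < pos (suc i) →
                  (u ⟨$⟩ʳ c < u ⟨$⟩ʳ pos (inject₁ i) × u ⟨$⟩ʳ c < u ⟨$⟩ʳ pos (suc j)) ⊎
                  (u ⟨$⟩ʳ pos (suc i) < u ⟨$⟩ʳ c × u ⟨$⟩ʳ pos (suc j) < u ⟨$⟩ʳ c)
        between c a<c c<b
          rewrite u-pos {inject₁ i} | u-pos {suc i} | u-pos {suc j}
          with F.<-cmp (u ⟨$⟩ʳ c) (suc i)
        ... | tri> _ _ p = inj₂ (p , F.<-trans j<i p)
        ... | tri≈ _ p _ = contradiction c<b (F.<-irrefl (trans (sym pos-u) (cong pos p)))
        -- By `strip`, a value from `j + 1` to `i` would place `c` weakly left of `a`.
        ... | tri< p _ _ = inj₁ (≤∧≢⇒<ᶠ c≤i c≢i ,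
                ℕ.≰⇒> λ j≤c → ℕ.<⇒≱ a<c (subst (F._≤ pos (inject₁ i)) pos-u (strip (u ⟨$⟩ʳ c) j≤c c≤i)))
          where
          c≤i : u ⟨$⟩ʳ c F.≤ inject₁ i
          c≤i = <suc⇒≤inject₁ i p
          c≢i : u ⟨$⟩ʳ c ≢ inject₁ i
          c≢i eq = F.<-irrefl (trans (cong pos (sym eq)) pos-u) a<c
        forced : s j · u ∼ u
        forced = Forcing.forcing↓ C (s-cover u i (lifted⇒rising i lifted)) (s-cocover u j falling)
          (lifted⇒contracted i lifted) (strip (suc j) ℕ.≤-refl lower) b≤Q between
          (subst₂ F._≤_ (sym u-pos) (sym u-pos) lower)
          (subst₂ _<_ (sym u-pos) (sym u-pos) j<i)
      left : pos (inject₁ j) < pos (suc i)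
      left = ℕ.≰⇒> λ b≤Q → falling⇒uncontracted j falling (forced b≤Q)

  charge : ∀ i → Lifted i → (∃[ j ] Above i j) ⊎ (∃[ j ] Below i j)
  charge i lifted = go (lifted⇒gap i lifted)
    where
    go : (Σ[ r ∈ Fin (suc n) ] pos (inject₁ i) < r × r < pos (suc i)) → (∃[ j ] Above i j) ⊎ (∃[ j ] Below i j)
    go (r , a<r , r<b) with F.<-cmp (u ⟨$⟩ʳ r) (inject₁ i)
    ... | tri< p _ _ = inj₂ (gap⇒below i lifted r a<r p)
    ... | tri≈ _ p _ = contradiction a<r (F.<-irrefl (trans (cong pos (sym p)) pos-u))
    ... | tri> _ _ p = inj₁ (gap⇒above i lifted r r<b (≤∧≢⇒<ᶠ (inject₁<⇒suc≤ i p) λ eq →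
            F.<-irrefl (trans (sym pos-u) (cong pos (sym eq))) r<b))

  module _ (G D : Subset n) (G-lifted : ∀ {i} → i ∈ G → Lifted i)
           (D-falling : ∀ {j} → j ∈ D → Falling j) (falling-D : ∀ {j} → Falling j → j ∈ D) where

    ∣G∣≤∣D∣+∣D∣ : ∣ G ∣ ≤ ∣ D ∣ + ∣ D ∣
    ∣G∣≤∣D∣+∣D∣ = ∣∣-charge G D D Above Below (λ {i} i∈ → charged i (charge i (G-lifted i∈)))
                            above-injective below-injective
      where
      charged : ∀ i → (∃[ j ] Above i j) ⊎ (∃[ j ] Below i j) →
                (∃[ j ] j ∈ D × Above i j) ⊎ (∃[ j ] j ∈ D × Below i j)
      charged i (inj₁ (j , α)) = inj₁ (j , falling-D (Above.falling α) , α)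
      charged i (inj₂ (j , β)) = inj₂ (j , falling-D (Below.falling β) , β)

    -- Lifted arcs rise, so `D` lies in the complement of `G`.
    ∣D∣≤n∸∣G∣ : ∣ D ∣ ≤ n ∸ ∣ G ∣
    ∣D∣≤n∸∣G∣ = subst (∣ D ∣ ≤_) (∣∁p∣≡n∸∣p∣ G) (p⊆q⇒∣p∣≤∣q∣ λ {i} i∈D → x∉p⇒x∈∁p λ i∈G →
      F.<-asym (lifted⇒rising i (G-lifted i∈G)) (D-falling i∈D))

    ∣G∣≤2n/3 : ∣ G ∣ ≤ 2 * n / 3
    ∣G∣≤2n/3 = subst (_≤ 2 * n / 3) (m*n/n≡m ∣ G ∣ 3) (/-monoˡ-≤ 3 (begin
      ∣ G ∣ * 3                          ≡⟨ ℕ.*-comm ∣ G ∣ 3 ⟩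
      ∣ G ∣ + 2 * ∣ G ∣                  ≤⟨ ℕ.+-monoˡ-≤ (2 * ∣ G ∣) ∣G∣≤∣D∣+∣D∣ ⟩
      ∣ D ∣ + ∣ D ∣ + 2 * ∣ G ∣          ≡⟨ cong (λ d → ∣ D ∣ + d + 2 * ∣ G ∣) (ℕ.+-identityʳ ∣ D ∣) ⟨
      2 * ∣ D ∣ + 2 * ∣ G ∣              ≤⟨ ℕ.+-monoˡ-≤ (2 * ∣ G ∣) (ℕ.*-monoʳ-≤ 2 ∣D∣≤n∸∣G∣) ⟩
      2 * (n ∸ ∣ G ∣) + 2 * ∣ G ∣        ≡⟨ ℕ.*-distribˡ-+ 2 (n ∸ ∣ G ∣) ∣ G ∣ ⟨
      2 * (n ∸ ∣ G ∣ + ∣ G ∣)            ≡⟨ cong (2 *_) (ℕ.m∸n+n≡m (∣p∣≤n G)) ⟩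
      2 * n                              ∎))
      where open ℕ.≤-Reasoning

-- The falling arcs of `u` are the descents of `u ⁻¹`, which gives the second set passed to the
-- bound.
∣D_R∣≤2n/3 : (C : LatticeCongruence (suc n)) → Essential C → (u w v : S (suc n)) →
             π↓[ C ] w ↦ u → v ≈ w · u ⁻¹ → ∣ D_R v ∣ ≤ 2 * n / 3
∣D_R∣≤2n/3 C essential u w v (u∼w , smallest) v≈ =
  Bound.∣G∣≤2n/3 C essential u w u∼w (λ z z∼w → ≤L⇒⊑ u z (smallest z z∼w)) (D_R v) (D_R (u ⁻¹))
    (λ {i} i∈ → subst₂ _<_ (v≈ (suc i)) (v≈ (inject₁ i)) (∈D_R⇒descent v i i∈))
    (λ {j} → ∈D_R⇒descent (u ⁻¹) j) (λ {j} → descent⇒∈D_R (u ⁻¹) j)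

-- The subset `attained` gives one inequality and the general upper bound the other, so the descent
-- set of the extremal pair need not be determined exactly.
∣D_R∣≡2n/3 : ∀ n → 2 * n / 3 ≡ ∣ D_R (wₙ (suc n) · uₙ (suc n) ⁻¹) ∣
∣D_R∣≡2n/3 n = ℕ.≤-antisym (2n/3≤∣D_R∣ n)
  (∣D_R∣≤2n/3 (descentCongruence n) (descentCongruence-essential n) (uₙ (suc n)) (wₙ (suc n))
    (wₙ (suc n) · uₙ (suc n) ⁻¹) (uₙ-minimal n) λ _ → refl)

theorem5p5 : (n : ℕ) → 1 ≤ n →
    IsMaximum
    (λ d → Σ[ C ∈ LatticeCongruence n ] (Essential C ×
    (Σ[ w ∈ S n ] Σ[ v ∈ S n ] ((𝐒[ C ] w ↦ v) × d ≡ ∣ D_R v ∣))))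
    ((2 * (n ∸ 1)) / 3)
theorem5p5 (suc n) _ =
  (descentCongruence n , descentCongruence-essential n , wₙ (suc n) , wₙ (suc n) · uₙ (suc n) ⁻¹ ,
    (uₙ (suc n) , uₙ-minimal n , λ _ → refl) , ∣D_R∣≡2n/3 n) ,
  upper
  where
  upper : ∀ k → (Σ[ C ∈ LatticeCongruence (suc n) ] (Essential C ×
            (Σ[ w ∈ S (suc n) ] Σ[ v ∈ S (suc n) ] ((𝐒[ C ] w ↦ v) × k ≡ ∣ D_R v ∣)))) → k ≤ 2 * n / 3
  upper k (C , essential , w , v , (u , minimal , v≈) , k≡) =
    ℕ.≤-trans (ℕ.≤-reflexive k≡) (∣D_R∣≤2n/3 C essential u w v minimal v≈)
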